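{- Let $\mathbb{E}$ be an instance of $3\mathrm{LIN}(\mathbb{Z}_2)$ with $n$ variables and $m$ equations. If $\mathbb{E}$ is unsatisfiable, then $\mathcal{S}(\mathbb{E})$ has a Lovász–Schrijver refutation of degree $6$ and size polynomial in $n$ and $m$.
   Context: An instance $\mathbb{E}$ of $3\mathrm{LIN}(\mathbb{Z}_2)$ with variables $X_1,\dots,X_n$ is a finite system of linear equations over $\mathbb{Z}_2$, each of the form $\sum_{i\in I}X_i=b$ with $I\subseteq[n]$, $|I|\le3$, $b\in\{0,1\}$; it is unsatisfiable if no assignment in $\mathbb{Z}_2$ satisfies all equations. For such an equation $E$, $\mathcal{S}(E)$ is the set of linear inequalities $\sum_{i\in T}\bar X_i+\sum_{i\in I\setminus T}X_i-1\ge0$ for all $T\subseteq I$ with $|T|\equiv 1-b\pmod 2$, in variables $X_i$ and twin variables $\bar X_i$; $\mathcal{S}(\mathbb{E})$ is the union of $\mathcal{S}(E)$ over all equations $E$ of $\mathbb{E}$. A Lovász–Schrijver (LS) refutation of a set of inequalities $H$ is a sequence of real polynomial inequalities ending in $-1\ge0$, each being a member of $H$, an axiom ($X_i^2-X_i=0$, $\bar X_i^2-\bar X_i=0$, $X_i+\bar X_i-1=0$, each equation counted as two inequalities, and $X_i\ge0$, $\bar X_i\ge0$, $1-X_i\ge0$, $1-\bar X_i\ge0$, $1\ge0$), or obtained from earlier ones by addition ($P\ge0,Q\ge0\vdash P+Q\ge0$) or by multiplication by a positive real or by a variable or twin variable ($P\ge0\vdash YP\ge0$). Degree is the maximum total degree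 of its polynomials; size is the number of symbols with polynomials written as explicit sums of monomials. -}

module Defs where

open import Data.Nat using (ℕ; zero; suc; _+_; _*_; _≤_; _%_; _≡ᵇ_)
open import Data.Bool using (Bool; true; false; if_then_else_; _∧_)
open import Data.Fin using (Fin; toℕ)
open import Data.Fin.Subset using (Subset; _⊆_; _∩_; ∣_∣)
open import Data.Vec using (lookup; tabulate)
open import Data.List using (List; []; _∷_; _++_; map; foldr; length; allFin)
open import Data.List.Membership.Propositional using (_∈_)
open import Data.List.Relation.Unary.All using (All)
open import Data.Sum using (_⊎_; inj₁; inj₂)
open import Data.Product using (Σ; _×_; _,_; proj₁; proj₂)
open import Data.Rational using (ℚ; 0ℚ; 1ℚ; -_; _<_) renaming (_+_ to _+ℚ_; _*_ to _*ℚ_)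
open import Relation.Binary.PropositionalEquality using (_≡_)
open import Relation.Nullary using (¬_)
open import Data.Empty using (⊥)

bitℕ : Bool → ℕ
bitℕ false = 0
bitℕ true  = 1

-- An equation  Σ_{i ∈ I} X_i = b  with |I| ≤ 3.
record Equation (n : ℕ) : Set where
  constructor mkEq
  field
    I     : Subset n
    small : ∣ I ∣ ≤ 3
    b     : Bool
open Equation public

Instance : ℕ → ℕ → Set
Instance n m = Fin m → Equation n

SatEq : {n : ℕ} → (Fin n → Bool) → Equation n → Set
SatEq a E = ∣ I E ∩ tabulate a ∣ % 2 ≡ bitℕ (b E)

Unsatisfiable : {n m : ℕ} → Instance n m → Set
Unsatisfiable {n} {m} 𝔼 = ¬ (Σ (Fin n → Bool) λ a → (j : Fin m) → SatEq a (𝔼 j))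

-- inj₁ i is X_i, inj₂ i is the twin variable X̄_i.
Var : ℕ → Set
Var n = Fin n ⊎ Fin n

-- A monomial is a product of variables (a list, order irrelevant).
Monomial : ℕ → Set
Monomial n = List (Var n)

Term : ℕ → Set
Term n = ℚ × Monomial n

Poly : ℕ → Set
Poly n = List (Term n)

expo : {n : ℕ} → Monomial n → Var n → ℕ
expo [] v = 0
expo (inj₁ i ∷ μ) (inj₁ j) = (if toℕ i ≡ᵇ toℕ j then 1 else 0) + expo μ (inj₁ j)
expo (inj₂ i ∷ μ) (inj₂ j) = (if toℕ i ≡ᵇ toℕ j then 1 else 0) + expo μ (inj₂ j)
expo (inj₁ _ ∷ μ) (inj₂ j) = expo μ (inj₂ j)
expo (inj₂ _ ∷ μ) (inj₁ j) = expo μ (inj₁ j)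

allB : {A : Set} → (A → Bool) → List A → Bool
allB p xs = foldr (λ x acc → p x ∧ acc) true xs

sameMono : {n : ℕ} → Monomial n → Monomial n → Bool
sameMono {n} μ ν =
  allB (λ i → (expo μ (inj₁ i) ≡ᵇ expo ν (inj₁ i)) ∧ (expo μ (inj₂ i) ≡ᵇ expo ν (inj₂ i))) (allFin n)

coeff : {n : ℕ} → Poly n → Monomial n → ℚ
coeff [] μ = 0ℚ
coeff ((c , ν) ∷ P) μ = (if sameMono ν μ then c else 0ℚ) +ℚ coeff P μ

_≈P_ : {n : ℕ} → Poly n → Poly n → Set
P ≈P Q = ∀ μ → coeff P μ ≡ coeff Q μ

_⊕_ : {n : ℕ} → Poly n → Poly n → Poly n
P ⊕ Q = P ++ Q

scale : {n : ℕ} → ℚ → Poly n → Poly n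
scale c P = map (λ t → (c *ℚ proj₁ t , proj₂ t)) P

mulVar : {n : ℕ} → Var n → Poly n → Poly n
mulVar y P = map (λ t → (proj₁ t , y ∷ proj₂ t)) P

negP : {n : ℕ} → Poly n → Poly n
negP = scale (- 1ℚ)

constP : {n : ℕ} → ℚ → Poly n
constP c = (c , []) ∷ []

varP : {n : ℕ} → Var n → Poly n
varP y = (1ℚ , y ∷ []) ∷ []

ineqPoly : {n : ℕ} → Subset n → Subset n → Poly n
ineqPoly {n} I T =
  foldr (λ i acc → if lookup I i
                     then ((if lookup T i then (1ℚ , inj₂ i ∷ []) else (1ℚ , inj₁ i ∷ [])) ∷ acc)
                     else acc)
        ((- 1ℚ , []) ∷ []) (allFin n)

-- S(E) as a set (predicate) of polynomials P, meaning inequalities P ≥ 0.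
-- T ⊆ I with |T| ≡ 1 - b (mod 2), i.e. |T| + b odd.
S : {n m : ℕ} → Instance n m → Poly n → Set
S {n} {m} 𝔼 P =
  Σ (Fin m) λ j → Σ (Subset n) λ T →
    (T ⊆ I (𝔼 j)) × ((∣ T ∣ + bitℕ (b (𝔼 j))) % 2 ≡ 1) × (P ≈P ineqPoly (I (𝔼 j)) T)

-- Lovász–Schrijver axioms (each P meaning the inequality P ≥ 0)

data Axiom {n : ℕ} : Poly n → Set where
  boolean    : ∀ y P → P ≈P (((1ℚ , y ∷ y ∷ []) ∷ (- 1ℚ , y ∷ []) ∷ [])) → Axiom P
  boolean⁻   : ∀ y P → P ≈P negP (((1ℚ , y ∷ y ∷ []) ∷ (- 1ℚ , y ∷ []) ∷ [])) → Axiom P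
  twin       : ∀ i P → P ≈P (varP (inj₁ i) ⊕ (varP (inj₂ i) ⊕ constP (- 1ℚ))) → Axiom P
  twin⁻      : ∀ i P → P ≈P negP (varP (inj₁ i) ⊕ (varP (inj₂ i) ⊕ constP (- 1ℚ))) → Axiom P
  nonneg     : ∀ y P → P ≈P varP y → Axiom P
  upper      : ∀ y P → P ≈P (constP 1ℚ ⊕ negP (varP y)) → Axiom P
  one        : ∀ P → P ≈P constP 1ℚ → Axiom P

data Justified {n : ℕ} (H : Poly n → Set) (prev : List (Poly n)) (P : Poly n) : Set where
  hyp  : H P → Justified H prev P
  ax   : Axiom P → Justified H prev P
  add  : ∀ Q R → Q ∈ prev → R ∈ prev → P ≈P (Q ⊕ R) → Justified H prev P
  pos  : ∀ c Q → 0ℚ < c → Q ∈ prev → P ≈P scale c Q → Justified H prev P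
  mul  : ∀ y Q → Q ∈ prev → P ≈P mulVar y Q → Justified H prev P

-- A derivation as a sequence of lines, stored in reverse order
-- (head = last line).
data ValidSeq {n : ℕ} (H : Poly n → Set) : List (Poly n) → Set where
  []  : ValidSeq H []
  _∷_ : ∀ {P prev} → Justified H prev P → ValidSeq H prev → ValidSeq H (P ∷ prev)

Refutation : {n : ℕ} → (Poly n → Set) → List (Poly n) → Set
Refutation H [] = ⊥
Refutation H (P ∷ prev) = ValidSeq H (P ∷ prev) × (P ≈P constP (- 1ℚ))

DegreeAtMost : {n : ℕ} → ℕ → List (Poly n) → Set
DegreeAtMost d π = All (λ P → All (λ t → length (proj₂ t) ≤ d) P) π

-- symbols of a term: one for the coefficient plus one per variable factor
polySize : {n : ℕ} → Poly n → ℕ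
polySize P = foldr (λ t acc → suc (length (proj₂ t)) + acc) 0 P

proofSize : {n : ℕ} → List (Poly n) → ℕ
proofSize π = foldr (λ P acc → suc (polySize P) + acc) 0 π

{-# OPTIONS --safe #-}
-- A linear form Λ with integer coefficients is ≡ β (mod 2) exactly when (Λ − t)(Λ − t − 2) ≥ 0
-- for all integers t ≡ β (mod 2).  These inequalities, for t in a polynomially long window,
-- replace the (wide) sums of equations that occur in Gaussian elimination.  They hold trivially
-- for Λ = 0, β = 0.  To add an equation Σ_{i∈I} X_i = b, split into the at most eight assignments
-- to I: under an assignment violating the equation everything follows from the hypotheses, under
-- one satisfying it Σ_{i∈I} X_i is a constant v ≡ b, so that the inequality for t follows from
-- the old one for t − v.  The case products have degree at most 3, and the remaining factors
-- at most 3 more.  If the system is unsatisfiable, some of its equations add up to 0 = 1; then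
-- all coefficients of the final Λ are even, and its variables can be removed again one at a time
-- by the same case distinction.  With β = 1 and t = −1 this leaves (0 + 1)(0 + 1 − 2) = −1 ≥ 0.

module Submission where

open import Defs
open import Data.Nat using (ℕ; zero; suc; _+_; _≡ᵇ_; _*_; _≤_; z≤n; s≤s; _%_; _∸_; _≤?_; _^_)
import Data.Nat.Properties as ℕₚ
open import Data.Bool using (Bool; true; false; if_then_else_; _∧_; not; _xor_)
open import Data.Bool.Properties using (∧-conicalˡ; ∧-conicalʳ; T-≡; ⇔→≡; ¬-not)
open import Data.Fin using (Fin; toℕ; zero; suc)
import Data.Fin.Properties as Finₚ
open import Data.List as List using (List; []; _∷_; _++_; map; allFin; length; foldr; filter; upTo)
import Data.List.Properties as Listₚ
open import Data.List.Membership.Propositional using (_∈_)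
open import Data.List.Membership.Propositional.Properties using (∈-allFin; ∈-map⁺; ∈-filter⁺; ∈-upTo⁺)
open import Data.List.Relation.Unary.Any using (here; there)
open import Data.Sum using (_⊎_; inj₁; inj₂)
import Data.Sum.Properties as Sumₚ
open import Data.Product using (Σ; _×_; _,_; proj₁; proj₂)
open import Data.Rational using (ℚ; 0ℚ; 1ℚ; -_) renaming (_+_ to _+ℚ_; _*_ to _*ℚ_; _<_ to _<ℚ_; _≤_ to _≤ℚ_)
import Data.Rational.Properties as ℚₚ
open import Relation.Binary.PropositionalEquality hiding (J)
open import Relation.Nullary using (¬_; yes; no)
open import Function using (_∘_; mk⇔; Equivalence; const; id)
open import Algebra.Bundles using (CommutativeSemiring)
open import Level using (0ℓ)
open import Data.Empty using (⊥-elim)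
import Algebra.Solver.Ring.NaturalCoefficients.Default as NatSolver
open import Data.List.Relation.Unary.All as All using (All; []; _∷_)
import Data.List.Relation.Unary.All.Properties as Allₚ
open import Relation.Binary.Definitions using (tri<; tri≈; tri>)
import Algebra.Properties.Group ℚₚ.+-0-group as ℚGroup
open import Relation.Nullary.Decidable using (from-yes; _×-dec_)
open import Data.Fin.Subset using (Subset; _∩_; ∣_∣)
open import Data.Vec as Vec using (lookup; Vec; []; _∷_; replicate; zipWith)
open import Data.Vec.Functional using (updateAt)
open import Data.Vec.Functional.Properties using (updateAt-updates; updateAt-minimal)
open import Data.List.Relation.Unary.Unique.Propositional using (Unique)
open import Data.List.Relation.Unary.AllPairs using ([]; _∷_)
import Data.Bool.Properties as Boolₚ
import Data.Vec.Properties as Vecₚ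
open import Data.Bool.Solver using (module xor-∧-Solver)
open import Data.Fin.Subset.Properties using (p∩q⊆p; ∣p∩q∣≤∣p∣)
import Data.List.Relation.Unary.Unique.Propositional.Properties as Uniqueₚ
open import Data.Rational.Solver using (module +-*-Solver)
open ≡-Reasoning

-- The rules multiply an inequality only by positive numbers and by variables, never by another
-- inequality. An equation, held as two opposite inequalities, can be multiplied by any polynomial.
-- So a gap inequality is multiplied only by the literals of a case, and all else is correction by
-- polynomial multiples of equations, which are axioms or hold in that case. Each passage from t to
-- t - v consumes part of the window. While equations are added, v lies between 0 and 3, so only the
-- lower end is used up; while variables are removed, v is 0 or minus the coefficient, so only the
-- upper end is. Coefficients stay integers and are not reduced modulo 2 on the way. Each equation
-- enters the contradictory sum at most once, so no coefficient exceeds m, and a window of about n·m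
-- + 4m integers is wide enough. Size needs one more precaution: before it serves as a premise,
-- every derived inequality is rewritten as the gap of a linear form with at most n terms, so that
-- the lengths of lines do not compound over the stages.

module _ {n : ℕ} where

  -- Polynomials up to equality of coefficients

  infix 4 _~_ _≋_
  infixl 7 _⊗_

  _~_ : Monomial n → Monomial n → Set
  μ ~ ν = ∀ v → expo μ v ≡ expo ν v

  allB⇒∈ : {A : Set} (p : A → Bool) (xs : List A) → allB p xs ≡ true → ∀ {x} → x ∈ xs → p x ≡ true
  allB⇒∈ p (x ∷ xs) h (here refl) = ∧-conicalˡ (p x) _ h
  allB⇒∈ p (x ∷ xs) h (there m)   = allB⇒∈ p xs (∧-conicalʳ (p x) _ h) m

  all⇒allB : {A : Set} (p : A → Bool) → (∀ x → p x ≡ true) → ∀ xs → allB p xs ≡ true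
  all⇒allB p h []       = refl
  all⇒allB p h (x ∷ xs) = cong₂ _∧_ (h x) (all⇒allB p h xs)

  ≡ᵇ-refl : ∀ k → (k ≡ᵇ k) ≡ true
  ≡ᵇ-refl zero    = refl
  ≡ᵇ-refl (suc k) = ≡ᵇ-refl k

  ≡ᵇ⇒≡ : ∀ {k l} → (k ≡ᵇ l) ≡ true → k ≡ l
  ≡ᵇ⇒≡ {k} {l} h = ℕₚ.≡ᵇ⇒≡ k l (Equivalence.from T-≡ h)

  sameMono⇒~ : ∀ {μ ν : Monomial n} → sameMono μ ν ≡ true → μ ~ ν
  sameMono⇒~ h (inj₁ i) = ≡ᵇ⇒≡ (∧-conicalˡ _ _ (allB⇒∈ _ (allFin n) h (∈-allFin i)))
  sameMono⇒~ h (inj₂ i) = ≡ᵇ⇒≡ (∧-conicalʳ _ _ (allB⇒∈ _ (allFin n) h (∈-allFin i)))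

  ~⇒sameMono : ∀ {μ ν : Monomial n} → μ ~ ν → sameMono μ ν ≡ true
  ~⇒sameMono {μ} {ν} h = all⇒allB _ eq (allFin n)
    where
    eq : ∀ i → (expo μ (inj₁ i) ≡ᵇ expo ν (inj₁ i)) ∧ (expo μ (inj₂ i) ≡ᵇ expo ν (inj₂ i)) ≡ true
    eq i rewrite h (inj₁ i) | h (inj₂ i) = cong₂ _∧_ (≡ᵇ-refl (expo ν (inj₁ i))) (≡ᵇ-refl (expo ν (inj₂ i)))

  sameMono-⇔ : ∀ {μ μ′ ν ν′ : Monomial n} → (μ ~ ν → μ′ ~ ν′) → (μ′ ~ ν′ → μ ~ ν) →
               sameMono μ ν ≡ sameMono μ′ ν′
  sameMono-⇔ {μ} {μ′} {ν} {ν′} f g = ⇔→≡ {z = true} (mk⇔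
    (λ h → ~⇒sameMono {μ′} {ν′} (f (sameMono⇒~ {μ} {ν} h)))
    (λ h → ~⇒sameMono {μ} {ν} (g (sameMono⇒~ {μ′} {ν′} h))))

  expo-∷ : ∀ y μ (v : Var n) → expo (y ∷ μ) v ≡ expo (y ∷ []) v + expo μ v
  expo-∷ (inj₁ i) μ (inj₁ j) = cong (_+ expo μ (inj₁ j)) (sym (ℕₚ.+-identityʳ _))
  expo-∷ (inj₁ i) μ (inj₂ j) = refl
  expo-∷ (inj₂ i) μ (inj₁ j) = refl
  expo-∷ (inj₂ i) μ (inj₂ j) = cong (_+ expo μ (inj₂ j)) (sym (ℕₚ.+-identityʳ _))

  expo-++ : ∀ μ ν (v : Var n) → expo (μ ++ ν) v ≡ expo μ v + expo ν v
  expo-++ []      ν v = refl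
  expo-++ (y ∷ μ) ν v = begin
    expo (y ∷ (μ ++ ν)) v                   ≡⟨ expo-∷ y (μ ++ ν) v ⟩
    expo (y ∷ []) v + expo (μ ++ ν) v       ≡⟨ cong (expo (y ∷ []) v +_) (expo-++ μ ν v) ⟩
    expo (y ∷ []) v + (expo μ v + expo ν v) ≡⟨ ℕₚ.+-assoc (expo (y ∷ []) v) _ _ ⟨
    expo (y ∷ []) v + expo μ v + expo ν v   ≡⟨ cong (_+ expo ν v) (expo-∷ y μ v) ⟨
    expo (y ∷ μ) v + expo ν v ∎

  ++-comm~ : ∀ (μ ν : Monomial n) → (μ ++ ν) ~ (ν ++ μ)
  ++-comm~ μ ν v = trans (expo-++ μ ν v) (trans (ℕₚ.+-comm (expo μ v) _) (sym (expo-++ ν μ v)))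

  expo-self : ∀ (y : Var n) → expo (y ∷ []) y ≡ 1
  expo-self (inj₁ i) rewrite ≡ᵇ-refl (toℕ i) = refl
  expo-self (inj₂ i) rewrite ≡ᵇ-refl (toℕ i) = refl

  expo-other : ∀ (y v : Var n) → ¬ (y ≡ v) → expo (y ∷ []) v ≡ 0
  expo-other (inj₁ i) (inj₂ j) y≢v = refl
  expo-other (inj₂ i) (inj₁ j) y≢v = refl
  expo-other (inj₁ i) (inj₁ j) y≢v
    rewrite ¬-not {toℕ i ≡ᵇ toℕ j} {true} (λ h → y≢v (cong inj₁ (Finₚ.toℕ-injective (≡ᵇ⇒≡ h)))) = refl
  expo-other (inj₂ i) (inj₂ j) y≢v
    rewrite ¬-not {toℕ i ≡ᵇ toℕ j} {true} (λ h → y≢v (cong inj₂ (Finₚ.toℕ-injective (≡ᵇ⇒≡ h)))) = refl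

  -- Needed for `mulVar-cong`: the coefficient of `mulVar y P` at μ is 0 if y does not divide μ, and
  -- otherwise the coefficient of P at the quotient. Either way it depends on P only through
  -- `coeff`.
  factor : ∀ y (μ : Monomial n) → (expo μ y ≡ 0) ⊎ Σ (Monomial n) λ μ′ → μ ~ (y ∷ μ′)
  factor y []      = inj₁ refl
  factor y (z ∷ μ) with Sumₚ.≡-dec Finₚ._≟_ Finₚ._≟_ z y
  ... | yes refl = inj₂ (μ , λ _ → refl)
  ... | no  z≢y with factor y μ
  ...   | inj₁ h = inj₁ (trans (expo-∷ z μ y) (cong₂ _+_ (expo-other z y z≢y) h))
  ...   | inj₂ (μ′ , h) = inj₂ (z ∷ μ′ , λ v → begin
      expo (z ∷ μ) v                                 ≡⟨ expo-∷ z μ v ⟩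
      expo (z ∷ []) v + expo μ v                     ≡⟨ cong (expo (z ∷ []) v +_) (h v) ⟩
      expo (z ∷ []) v + expo (y ∷ μ′) v              ≡⟨ expo-++ (z ∷ []) (y ∷ μ′) v ⟨
      expo ((z ∷ y ∷ []) ++ μ′) v                    ≡⟨ expo-++ (z ∷ y ∷ []) μ′ v ⟩
      expo (z ∷ y ∷ []) v + expo μ′ v                ≡⟨ cong (_+ expo μ′ v) (++-comm~ (z ∷ []) (y ∷ []) v) ⟩
      expo (y ∷ z ∷ []) v + expo μ′ v                ≡⟨ expo-++ (y ∷ z ∷ []) μ′ v ⟨
      expo (y ∷ z ∷ μ′) v ∎)

  -- A record around ≈P, so that both sides can be inferred from a proof.
  record _≋_ (P Q : Poly n) : Set where
    constructor mk
    field at : P ≈P Q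
  open _≋_ public

  ≋-refl : ∀ {P} → P ≋ P
  ≋-refl = mk λ _ → refl

  ≋-sym : ∀ {P Q} → P ≋ Q → Q ≋ P
  ≋-sym h = mk λ μ → sym (at h μ)

  ≋-trans : ∀ {P Q R} → P ≋ Q → Q ≋ R → P ≋ R
  ≋-trans h k = mk λ μ → trans (at h μ) (at k μ)

  ≡⇒≋ : ∀ {P Q} → P ≡ Q → P ≋ Q
  ≡⇒≋ refl = ≋-refl

  coeff-++ : ∀ P Q (μ : Monomial n) → coeff (P ++ Q) μ ≡ coeff P μ +ℚ coeff Q μ
  coeff-++ []            Q μ = sym (ℚₚ.+-identityˡ _)
  coeff-++ ((c , ν) ∷ P) Q μ = trans (cong (c′ +ℚ_) (coeff-++ P Q μ)) (sym (ℚₚ.+-assoc c′ (coeff P μ) (coeff Q μ)))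
    where c′ = if sameMono ν μ then c else 0ℚ

  ++-cong : ∀ {P P′ Q Q′ : Poly n} → P ≋ P′ → Q ≋ Q′ → (P ++ Q) ≋ (P′ ++ Q′)
  ++-cong {P} {P′} {Q} {Q′} h k = mk λ μ →
    trans (coeff-++ P Q μ) (trans (cong₂ _+ℚ_ (at h μ) (at k μ)) (sym (coeff-++ P′ Q′ μ)))

  ++-comm : ∀ (P Q : Poly n) → (P ++ Q) ≋ (Q ++ P)
  ++-comm P Q = mk λ μ → trans (coeff-++ P Q μ) (trans (ℚₚ.+-comm (coeff P μ) _) (sym (coeff-++ Q P μ)))

  ∷-~ : ∀ c {μ ν} (P : Poly n) → μ ~ ν → ((c , μ) ∷ P) ≋ ((c , ν) ∷ P)
  ∷-~ c {μ} {ν} P h = mk λ κ → cong (λ b → (if b then c else 0ℚ) +ℚ coeff P κ)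
    (sameMono-⇔ {μ} {ν} {κ} {κ} (λ k v → trans (sym (h v)) (k v)) (λ k v → trans (h v) (k v)))

  coeff-scale : ∀ c P (μ : Monomial n) → coeff (scale c P) μ ≡ c *ℚ coeff P μ
  coeff-scale c []            μ = sym (ℚₚ.*-zeroʳ c)
  coeff-scale c ((d , ν) ∷ P) μ with sameMono ν μ
  ... | true  = trans (cong (c *ℚ d +ℚ_) (coeff-scale c P μ)) (sym (ℚₚ.*-distribˡ-+ c d _))
  ... | false = trans (cong₂ _+ℚ_ (sym (ℚₚ.*-zeroʳ c)) (coeff-scale c P μ)) (sym (ℚₚ.*-distribˡ-+ c 0ℚ _))

  scale-cong : ∀ c {P Q} → P ≋ Q → scale c P ≋ scale c Q
  scale-cong c {P} {Q} h = mk λ μ →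
    trans (coeff-scale c P μ) (trans (cong (c *ℚ_) (at h μ)) (sym (coeff-scale c Q μ)))

  coeff-mulVar-∷ : ∀ y P (μ μ′ : Monomial n) → μ ~ (y ∷ μ′) → coeff (mulVar y P) μ ≡ coeff P μ′
  coeff-mulVar-∷ y []            μ μ′ h = refl
  coeff-mulVar-∷ y ((c , ν) ∷ P) μ μ′ h = cong₂ (λ b r → (if b then c else 0ℚ) +ℚ r)
    (sameMono-⇔ {y ∷ ν} {ν} {μ} {μ′}
      (λ k v → ℕₚ.+-cancelˡ-≡ (expo (y ∷ []) v) _ _
        (trans (sym (expo-∷ y ν v)) (trans (k v) (trans (h v) (expo-∷ y μ′ v)))))
      (λ k v → trans (expo-∷ y ν v) (trans (cong (expo (y ∷ []) v +_) (k v))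
        (trans (sym (expo-∷ y μ′ v)) (sym (h v))))))
    (coeff-mulVar-∷ y P μ μ′ h)

  coeff-mulVar-0 : ∀ y P (μ : Monomial n) → expo μ y ≡ 0 → coeff (mulVar y P) μ ≡ 0ℚ
  coeff-mulVar-0 y []            μ h = refl
  coeff-mulVar-0 y ((c , ν) ∷ P) μ h
    rewrite ¬-not {sameMono (y ∷ ν) μ} {true} (λ e → ℕₚ.1+n≢0 (begin
      suc (expo ν y)             ≡⟨ cong (_+ expo ν y) (expo-self y) ⟨
      expo (y ∷ []) y + expo ν y ≡⟨ expo-∷ y ν y ⟨
      expo (y ∷ ν) y             ≡⟨ sameMono⇒~ {y ∷ ν} {μ} e y ⟩
      expo μ y                   ≡⟨ h ⟩
      0                          ∎))
    = trans (ℚₚ.+-identityˡ _) (coeff-mulVar-0 y P μ h)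

  mulVar-cong : ∀ y {P Q} → P ≋ Q → mulVar y P ≋ mulVar y Q
  mulVar-cong y {P} {Q} h = mk λ μ → case μ (factor y μ)
    where
    case : ∀ μ → (expo μ y ≡ 0) ⊎ Σ (Monomial n) (λ μ′ → μ ~ (y ∷ μ′)) → coeff (mulVar y P) μ ≡ coeff (mulVar y Q) μ
    case μ (inj₁ k)        = trans (coeff-mulVar-0 y P μ k) (sym (coeff-mulVar-0 y Q μ k))
    case μ (inj₂ (μ′ , k)) = trans (coeff-mulVar-∷ y P μ μ′ k) (trans (at h μ′) (sym (coeff-mulVar-∷ y Q μ μ′ k)))

  -- Products of polynomials and their semiring

  mulTerm : Term n → Poly n → Poly n
  mulTerm t = map (λ u → proj₁ t *ℚ proj₁ u , proj₂ t ++ proj₂ u)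

  _⊗_ : Poly n → Poly n → Poly n
  []      ⊗ Q = []
  (t ∷ P) ⊗ Q = mulTerm t Q ++ P ⊗ Q

  mulTerm-∷ : ∀ c y μ Q → mulVar y (mulTerm (c , μ) Q) ≡ mulTerm (c , y ∷ μ) Q
  mulTerm-∷ c y μ Q = sym (Listₚ.map-∘ Q)

  mulTerm-cong : ∀ t {P Q} → P ≋ Q → mulTerm t P ≋ mulTerm t Q
  mulTerm-cong (c , [])    h = scale-cong c h
  mulTerm-cong (c , y ∷ μ) {P} {Q} h =
    subst₂ _≋_ (mulTerm-∷ c y μ P) (mulTerm-∷ c y μ Q) (mulVar-cong y (mulTerm-cong (c , μ) h))

  mulTerm-mulTerm : ∀ t s R → mulTerm t (mulTerm s R) ≡ mulTerm (proj₁ t *ℚ proj₁ s , proj₂ t ++ proj₂ s) R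
  mulTerm-mulTerm t s R = trans (sym (Listₚ.map-∘ R))
    (Listₚ.map-cong (λ u → cong₂ _,_ (sym (ℚₚ.*-assoc (proj₁ t) (proj₁ s) (proj₁ u)))
                                     (sym (Listₚ.++-assoc (proj₂ t) (proj₂ s) (proj₂ u)))) R)

  mulTerm-⊗ : ∀ t Q R → mulTerm t Q ⊗ R ≡ mulTerm t (Q ⊗ R)
  mulTerm-⊗ t []      R = refl
  mulTerm-⊗ t (s ∷ Q) R = trans (cong₂ _++_ (sym (mulTerm-mulTerm t s R)) (mulTerm-⊗ t Q R))
                                (sym (Listₚ.map-++ _ (mulTerm s R) (Q ⊗ R)))

  ⊗-distribʳ : ∀ R P Q → (P ++ Q) ⊗ R ≡ P ⊗ R ++ Q ⊗ R
  ⊗-distribʳ R []      Q = refl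
  ⊗-distribʳ R (t ∷ P) Q = trans (cong (mulTerm t R ++_) (⊗-distribʳ R P Q))
                                 (sym (Listₚ.++-assoc (mulTerm t R) (P ⊗ R) (Q ⊗ R)))

  ⊗-assoc : ∀ P Q R → (P ⊗ Q) ⊗ R ≡ P ⊗ (Q ⊗ R)
  ⊗-assoc []      Q R = refl
  ⊗-assoc (t ∷ P) Q R = trans (⊗-distribʳ R (mulTerm t Q) (P ⊗ Q)) (cong₂ _++_ (mulTerm-⊗ t Q R) (⊗-assoc P Q R))

  ⊗-identityˡ : ∀ P → constP 1ℚ ⊗ P ≡ P
  ⊗-identityˡ P = trans (Listₚ.++-identityʳ _)
    (trans (Listₚ.map-cong (λ u → cong (_, proj₂ u) (ℚₚ.*-identityˡ (proj₁ u))) P) (Listₚ.map-id P))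

  ⊗-zeroʳ : ∀ P → P ⊗ [] ≡ []
  ⊗-zeroʳ []      = refl
  ⊗-zeroʳ (t ∷ P) = ⊗-zeroʳ P

  ++-swap : ∀ (P Q R : Poly n) → (P ++ Q ++ R) ≋ (Q ++ P ++ R)
  ++-swap P Q R = ≋-trans (≡⇒≋ (sym (Listₚ.++-assoc P Q R)))
    (≋-trans (++-cong (++-comm P Q) ≋-refl) (≡⇒≋ (Listₚ.++-assoc Q P R)))

  ⊗-∷ʳ : ∀ P t Q → P ⊗ (t ∷ Q) ≋ mulTerm t P ++ P ⊗ Q
  ⊗-∷ʳ []      t Q = ≋-refl
  ⊗-∷ʳ (s ∷ P) t Q = ≋-trans
    (++-cong {P = (proj₁ s *ℚ proj₁ t , proj₂ s ++ proj₂ t) ∷ []} {Q = mulTerm s Q ++ P ⊗ (t ∷ Q)}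
      (≋-trans (∷-~ _ {proj₂ s ++ proj₂ t} {proj₂ t ++ proj₂ s} [] (++-comm~ (proj₂ s) (proj₂ t)))
        (≡⇒≋ (cong (λ c → (c , proj₂ t ++ proj₂ s) ∷ []) (ℚₚ.*-comm (proj₁ s) (proj₁ t)))))
      (++-cong {P = mulTerm s Q} ≋-refl (⊗-∷ʳ P t Q)))
    (++-cong {P = (proj₁ t *ℚ proj₁ s , proj₂ t ++ proj₂ s) ∷ []} ≋-refl (++-swap (mulTerm s Q) (mulTerm t P) (P ⊗ Q)))

  ⊗-comm : ∀ P Q → P ⊗ Q ≋ Q ⊗ P
  ⊗-comm P []      = ≡⇒≋ (⊗-zeroʳ P)
  ⊗-comm P (t ∷ Q) = ≋-trans (⊗-∷ʳ P t Q) (++-cong {P = mulTerm t P} ≋-refl (⊗-comm P Q))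

  ⊗-congˡ : ∀ P {Q Q′} → Q ≋ Q′ → P ⊗ Q ≋ P ⊗ Q′
  ⊗-congˡ []      h = ≋-refl
  ⊗-congˡ (t ∷ P) h = ++-cong (mulTerm-cong t h) (⊗-congˡ P h)

  ⊗-cong : ∀ {P P′ Q Q′} → P ≋ P′ → Q ≋ Q′ → P ⊗ Q ≋ P′ ⊗ Q′
  ⊗-cong {P} {P′} {Q} {Q′} h k = ≋-trans (⊗-congˡ P k)
    (≋-trans (⊗-comm P Q′) (≋-trans (⊗-congˡ Q′ h) (⊗-comm Q′ P′)))

-- Serves the solver. Without subtraction, -1 and -v enter its goals as atoms; each identity is
-- stated with an explicit multiple of 1 + (-1) or v + (-v), which is cancelled afterwards.
polySemiring : ℕ → CommutativeSemiring 0ℓ 0ℓ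
polySemiring n = record
  { Carrier = Poly n
  ; _≈_ = _≋_
  ; _+_ = _++_
  ; _*_ = _⊗_
  ; 0#  = []
  ; 1#  = constP 1ℚ
  ; isCommutativeSemiring = isCommutativeSemiringˡ record
    { +-isCommutativeMonoid = isCommutativeMonoidˡ record
      { isSemigroup = record
        { isMagma = record { isEquivalence = ≋-isEquivalence ; ∙-cong = ++-cong }
        ; assoc = λ P Q R → ≡⇒≋ (Listₚ.++-assoc P Q R)
        }
      ; identityˡ = λ _ → ≋-refl
      ; comm = ++-comm
      }
    ; *-isCommutativeMonoid = isCommutativeMonoidˡ record
      { isSemigroup = record
        { isMagma = record { isEquivalence = ≋-isEquivalence ; ∙-cong = ⊗-cong }
        ; assoc = λ P Q R → ≡⇒≋ (⊗-assoc P Q R)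
        }
      ; identityˡ = λ P → ≡⇒≋ (⊗-identityˡ P)
      ; comm = ⊗-comm
      }
    ; distribʳ = λ R P Q → ≡⇒≋ (⊗-distribʳ R P Q)
    ; zeroˡ = λ _ → ≋-refl
    }
  }
  where
  open import Algebra.Structures.Biased (_≋_ {n})
  open import Relation.Binary.Structures using (IsEquivalence)
  ≋-isEquivalence : IsEquivalence (_≋_ {n})
  ≋-isEquivalence = record { refl = ≋-refl ; sym = ≋-sym ; trans = ≋-trans }

-- Derivations

module _ {n : ℕ} where

  Deg : ℕ → Poly n → Set
  Deg d = All (λ t → length (proj₂ t) ≤ d)

  Deg-mono : ∀ {d e P} → d ≤ e → Deg d P → Deg e P
  Deg-mono d≤e = All.map (λ h → ℕₚ.≤-trans h d≤e)

  Deg-⊗ : ∀ {d e} {P Q} → Deg d P → Deg e Q → Deg (d + e) (P ⊗ Q)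
  Deg-⊗ []                 q = []
  Deg-⊗ {P = t ∷ P} (p ∷ ps) q = Allₚ.++⁺
    (Allₚ.map⁺ (All.map (λ {u} h → subst (_≤ _) (sym (Listₚ.length-++ (proj₂ t))) (ℕₚ.+-mono-≤ p h)) q))
    (Deg-⊗ ps q)

  length-⊗ : ∀ (P Q : Poly n) → length (P ⊗ Q) ≡ length P * length Q
  length-⊗ []      Q = refl
  length-⊗ (t ∷ P) Q = trans (Listₚ.length-++ (mulTerm t Q)) (cong₂ _+_ (Listₚ.length-map _ Q) (length-⊗ P Q))

  scale-scale : ∀ c d (P : Poly n) → scale c (scale d P) ≋ scale (c *ℚ d) P
  scale-scale c d P = mk λ μ → begin
    coeff (scale c (scale d P)) μ ≡⟨ coeff-scale c (scale d P) μ ⟩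
    c *ℚ coeff (scale d P) μ      ≡⟨ cong (c *ℚ_) (coeff-scale d P μ) ⟩
    c *ℚ (d *ℚ coeff P μ)         ≡⟨ ℚₚ.*-assoc c d _ ⟨
    (c *ℚ d) *ℚ coeff P μ         ≡⟨ coeff-scale (c *ℚ d) P μ ⟨
    coeff (scale (c *ℚ d) P) μ    ∎

  scale-comm : ∀ c d (P : Poly n) → scale c (scale d P) ≋ scale d (scale c P)
  scale-comm c d P = ≋-trans (scale-scale c d P)
    (≋-trans (≡⇒≋ (cong (λ e → scale e P) (ℚₚ.*-comm c d))) (≋-sym (scale-scale d c P)))

  scale-1 : ∀ (P : Poly n) → scale 1ℚ P ≋ P
  scale-1 P = mk λ μ → trans (coeff-scale 1ℚ P μ) (ℚₚ.*-identityˡ _)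

  scale-0 : ∀ (P : Poly n) → scale 0ℚ P ≋ []
  scale-0 P = mk λ μ → trans (coeff-scale 0ℚ P μ) (ℚₚ.*-zeroˡ (coeff P μ))

  negP-involutive : ∀ (P : Poly n) → negP (negP P) ≋ P
  negP-involutive P = ≋-trans (scale-scale (- 1ℚ) (- 1ℚ) P) (scale-1 P)

  negP-inverseʳ : ∀ (P : Poly n) → P ++ negP P ≋ []
  negP-inverseʳ P = mk λ μ → begin
    coeff (P ++ negP P) μ               ≡⟨ coeff-++ P (negP P) μ ⟩
    coeff P μ +ℚ coeff (negP P) μ       ≡⟨ cong (coeff P μ +ℚ_) (coeff-scale (- 1ℚ) P μ) ⟩
    coeff P μ +ℚ (- 1ℚ) *ℚ coeff P μ    ≡⟨ cong (coeff P μ +ℚ_) (ℚₚ.neg-distribˡ-* 1ℚ (coeff P μ)) ⟨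
    coeff P μ +ℚ (- (1ℚ *ℚ coeff P μ))  ≡⟨ cong (λ r → coeff P μ +ℚ (- r)) (ℚₚ.*-identityˡ (coeff P μ)) ⟩
    coeff P μ +ℚ (- coeff P μ)          ≡⟨ ℚₚ.+-inverseʳ (coeff P μ) ⟩
    0ℚ                                  ∎

  record Proof (H : Poly n → Set) (D W K : ℕ) (π : List (Poly n)) : Set where
    field
      valid : ValidSeq H π
      lines : All (λ P → Deg D P × length P ≤ W) π
      short : length π ≤ K

  open Proof

  module _ (H : Poly n → Set) (w : ℕ) where

    -- Trees compose without reference to the lines already written. Their polynomials are plain
    -- concatenations, with no terms collected, so a tree whose leaves have at most w terms has at
    -- most `size` times w terms at every node: `size` alone controls both the number and the length
    -- of the lines.
    data Tree (A : Poly n → Set) : ℕ → Poly n → Set where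
      given : ∀ {d P} → A P → Deg d P → length P ≤ w → Tree A d P
      base  : ∀ {d P} → H P ⊎ Axiom P → Deg d P → length P ≤ w → Tree A d P
      plus  : ∀ {d P Q} → Tree A d P → Tree A d Q → Tree A d (P ++ Q)
      times : ∀ {d P} c → 0ℚ <ℚ c → Tree A d P → Tree A d (scale c P)
      var   : ∀ {d P} y → Tree A d P → Tree A (suc d) (mulVar y P)

    size : ∀ {A d P} → Tree A d P → ℕ
    size (given _ _ _) = 1
    size (base _ _ _)  = 1
    size (plus T U)    = suc (size T + size U)
    size (times _ _ T) = suc (size T)
    size (var _ T)     = suc (size T)

    Tree-Deg : ∀ {A d P} → Tree A d P → Deg d P
    Tree-Deg (given _ h _) = h
    Tree-Deg (base _ h _)  = h
    Tree-Deg (plus T U)    = Allₚ.++⁺ (Tree-Deg T) (Tree-Deg U)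
    Tree-Deg (times c _ T) = Allₚ.map⁺ (Tree-Deg T)
    Tree-Deg (var y T)     = Allₚ.map⁺ (All.map s≤s (Tree-Deg T))

    Tree-length : ∀ {A d P} (T : Tree A d P) → length P ≤ size T * w
    Tree-length (given _ _ h) = ℕₚ.≤-trans h (ℕₚ.m≤m+n w 0)
    Tree-length (base _ _ h)  = ℕₚ.≤-trans h (ℕₚ.m≤m+n w 0)
    Tree-length (plus {P = P} {Q} T U) = ℕₚ.≤-trans
      (ℕₚ.≤-reflexive (Listₚ.length-++ P)) (ℕₚ.≤-trans
      (ℕₚ.+-mono-≤ (Tree-length T) (Tree-length U)) (ℕₚ.≤-trans
      (ℕₚ.≤-reflexive (sym (ℕₚ.*-distribʳ-+ w (size T) (size U))))
      (ℕₚ.m≤n+m _ w)))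
    Tree-length (times {P = P} c _ T) = ℕₚ.≤-trans (ℕₚ.≤-reflexive (Listₚ.length-map _ P))
      (ℕₚ.≤-trans (Tree-length T) (ℕₚ.m≤n+m _ w))
    Tree-length (var {P = P} y T) = ℕₚ.≤-trans (ℕₚ.≤-reflexive (Listₚ.length-map _ P))
      (ℕₚ.≤-trans (Tree-length T) (ℕₚ.m≤n+m _ w))

    Tree-raise : ∀ {A d e P} → d ≤ e → (T : Tree A d P) → Σ (Tree A e P) λ U → size U ≡ size T
    Tree-raise d≤e (given a h l) = given a (Deg-mono d≤e h) l , refl
    Tree-raise d≤e (base a h l)  = base a (Deg-mono d≤e h) l , refl
    Tree-raise d≤e (plus T U) with Tree-raise d≤e T | Tree-raise d≤e U
    ... | T′ , p | U′ , q = plus T′ U′ , cong₂ (λ a b → suc (a + b)) p q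
    Tree-raise d≤e (times c h T) with Tree-raise d≤e T
    ... | T′ , p = times c h T′ , cong suc p
    Tree-raise (s≤s d≤e) (var y T) with Tree-raise d≤e T
    ... | T′ , p = var y T′ , cong suc p

    Extension : ℕ → ℕ → ℕ → List (Poly n) → (List (Poly n) → Set) → Set
    Extension D W K π G = Σ (List (Poly n)) λ π′ → Proof H D W K π′ × (∀ {Q} → Q ∈ π → Q ∈ π′) × G π′

    newLine : ∀ {D W K π P} → Proof H D W K π → Deg D P → length P ≤ W → Justified H π P →
              Extension D W (suc K) π (P ∈_)
    newLine {π = π} {P} p h l j = P ∷ π
      , record { valid = j ∷ valid p ; lines = (h , l) ∷ lines p ; short = s≤s (short p) }
      , there , here refl

    Extension-≤ : ∀ {D W K K′ π G} → K ≤ K′ → Extension D W K π G → Extension D W K′ π G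
    Extension-≤ K≤K′ (π′ , p , i , g) =
      π′ , record { valid = valid p ; lines = lines p ; short = ℕₚ.≤-trans (short p) K≤K′ } , i , g

    compile : ∀ {A D W K d P π} (T : Tree A d P) → d ≤ D → size T * w ≤ W → (∀ {Q} → A Q → Q ∈ π) →
              Proof H D W K π → Extension D W (size T + K) π (P ∈_)
    compile {π = π} (given a h l) d≤D s A⊆ p = Extension-≤ (ℕₚ.n≤1+n _) (π , p , (λ i → i) , A⊆ a)
    compile (base b h l) d≤D s A⊆ p = newLine p (Deg-mono d≤D h) (ℕₚ.≤-trans (ℕₚ.≤-trans l (ℕₚ.m≤m+n w 0)) s) (just b)
      where
      just : ∀ {π P} → H P ⊎ Axiom P → Justified H π P
      just (inj₁ h) = hyp h
      just (inj₂ a) = ax a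
    compile {K = K} (plus T U) d≤D s A⊆ p
      with compile T d≤D (ℕₚ.≤-trans (ℕₚ.*-monoˡ-≤ w (ℕₚ.≤-trans (ℕₚ.m≤m+n (size T) (size U)) (ℕₚ.n≤1+n _))) s) A⊆ p
    ... | π₁ , p₁ , i₁ , T∈
      with compile U d≤D (ℕₚ.≤-trans (ℕₚ.*-monoˡ-≤ w (ℕₚ.≤-trans (ℕₚ.m≤n+m (size U) (size T)) (ℕₚ.n≤1+n _))) s) (λ a → i₁ (A⊆ a)) p₁
    ... | π₂ , p₂ , i₂ , U∈
      with newLine p₂ (Deg-mono d≤D (Tree-Deg (plus T U))) (ℕₚ.≤-trans (Tree-length (plus T U)) s)
             (add _ _ (i₂ T∈) U∈ (λ _ → refl))
    ... | π₃ , p₃ , i₃ , ∈₃ = Extension-≤ (s≤s (ℕₚ.≤-reflexive lem)) (π₃ , p₃ , (λ i → i₃ (i₂ (i₁ i))) , ∈₃)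
      where
      lem : size U + (size T + K) ≡ size T + size U + K
      lem = trans (sym (ℕₚ.+-assoc (size U) (size T) K)) (cong (_+ K) (ℕₚ.+-comm (size U) (size T)))
    compile (times c 0<c T) d≤D s A⊆ p
      with compile T d≤D (ℕₚ.≤-trans (ℕₚ.m≤n+m _ w) s) A⊆ p
    ... | π₁ , p₁ , i₁ , T∈
      with newLine p₁ (Deg-mono d≤D (Tree-Deg (times c 0<c T))) (ℕₚ.≤-trans (Tree-length (times c 0<c T)) s)
             (pos c _ 0<c T∈ (λ _ → refl))
    ... | π₂ , p₂ , i₂ , ∈₂ = π₂ , p₂ , (λ i → i₂ (i₁ i)) , ∈₂
    compile (var y T) d≤D s A⊆ p
      with compile T (ℕₚ.≤-trans (ℕₚ.n≤1+n _) d≤D) (ℕₚ.≤-trans (ℕₚ.m≤n+m _ w) s) A⊆ p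
    ... | π₁ , p₁ , i₁ , T∈
      with newLine p₁ (Deg-mono d≤D (Tree-Deg (var y T))) (ℕₚ.≤-trans (Tree-length (var y T)) s)
             (mul y _ T∈ (λ _ → refl))
    ... | π₂ , p₂ , i₂ , ∈₂ = π₂ , p₂ , (λ i → i₂ (i₁ i)) , ∈₂

    -- Equality of coefficients is applied once, at the root, so that the combinators below can work
    -- modulo `_≋_` while the tree keeps its literal polynomials.
    record Derives (A : Poly n → Set) (d k : ℕ) (P : Poly n) : Set where
      constructor derives
      field
        {poly} : Poly n
        tree   : Tree A d poly
        conv   : poly ≋ P
        cost   : size tree ≤ k

    0<1 : 0ℚ <ℚ 1ℚ
    0<1 = from-yes (0ℚ ℚₚ.<? 1ℚ)

    -- Multiplication by 1 restates the uncollected root of the tree as P itself. Later trees start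
    -- from this short line, hence the separate bounds on P and on the tree.
    append : ∀ {A D W K k π P} → Derives A D k P → Deg D P → length P ≤ W → k * w ≤ W →
             (∀ {Q} → A Q → Q ∈ π) → Proof H D W K π → Extension D W (suc k + K) π (P ∈_)
    append {k = k} (derives T P≋ s) h l kw A⊆ p
      with compile T ℕₚ.≤-refl (ℕₚ.≤-trans (ℕₚ.*-monoˡ-≤ w s) kw) A⊆ p
    ... | π₁ , p₁ , i₁ , T∈
      with newLine p₁ h l (pos 1ℚ _ 0<1 T∈ (at (≋-trans (≋-sym P≋) (≋-sym (scale-1 _)))))
    ... | π₂ , p₂ , i₂ , ∈₂ = Extension-≤ (s≤s (ℕₚ.+-monoˡ-≤ _ s)) (π₂ , p₂ , (λ i → i₂ (i₁ i)) , ∈₂)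

    appendAll : ∀ {A D W K k π Ps} → All (λ P → Derives A D k P × Deg D P × length P ≤ W) Ps → k * w ≤ W →
                (∀ {Q} → A Q → Q ∈ π) → Proof H D W K π →
                Extension D W (length Ps * suc k + K) π (λ π′ → ∀ {P} → P ∈ Ps → P ∈ π′)
    appendAll {π = π} [] kw A⊆ p = π , p , (λ i → i) , λ ()
    appendAll {K = K} {k} {Ps = _ ∷ Ps} ((δ , h , l) ∷ ds) kw A⊆ p with append δ h l kw A⊆ p
    ... | π₁ , p₁ , i₁ , ∈₁ with appendAll ds kw (λ a → i₁ (A⊆ a)) p₁
    ... | π₂ , p₂ , i₂ , ⊆₂ = Extension-≤ (ℕₚ.≤-reflexive lem)
            (π₂ , p₂ , (λ i → i₂ (i₁ i)) , λ { (here refl) → i₂ ∈₁ ; (there i) → ⊆₂ i })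
      where
      lem : length Ps * suc k + (suc k + K) ≡ suc k + length Ps * suc k + K
      lem = trans (sym (ℕₚ.+-assoc (length Ps * suc k) (suc k) K)) (cong (_+ K) (ℕₚ.+-comm (length Ps * suc k) (suc k)))

    module _ {A : Poly n → Set} where

      infix 1 _⊢[_]_
      _⊢[_]_ : ℕ → ℕ → Poly n → Set
      d ⊢[ k ] P = Derives A d k P

      ⊢-≋ : ∀ {d k P Q} → P ≋ Q → d ⊢[ k ] P → d ⊢[ k ] Q
      ⊢-≋ h (derives T p s) = derives T (≋-trans p h) s

      ⊢-mono : ∀ {d e k l P} → d ≤ e → k ≤ l → d ⊢[ k ] P → e ⊢[ l ] P
      ⊢-mono d≤e k≤l (derives T p s) with Tree-raise d≤e T
      ... | U , q = derives U p (ℕₚ.≤-trans (ℕₚ.≤-reflexive q) (ℕₚ.≤-trans s k≤l))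

      ⊢-plus : ∀ {d k l P Q} → d ⊢[ k ] P → d ⊢[ l ] Q → d ⊢[ suc (k + l) ] P ++ Q
      ⊢-plus (derives T p s) (derives U q r) = derives (plus T U) (++-cong p q) (s≤s (ℕₚ.+-mono-≤ s r))

      ⊢-times : ∀ {d k P} c → 0ℚ <ℚ c → d ⊢[ k ] P → d ⊢[ suc k ] scale c P
      ⊢-times c h (derives T p s) = derives (times c h T) (scale-cong c p) (s≤s s)

      ⊢-var : ∀ {d k P} y → d ⊢[ k ] P → suc d ⊢[ suc k ] mulVar y P
      ⊢-var y (derives T p s) = derives (var y T) (mulVar-cong y p) (s≤s s)

      infix 1 _⊢₀[_]_
      -- An equation P = 0. Having both signs removes the restriction to positive multipliers:
      -- `⊢₀-scale` allows every rational factor and `⊢₀-⊗` every polynomial factor.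
      _⊢₀[_]_ : ℕ → ℕ → Poly n → Set
      d ⊢₀[ k ] P = (d ⊢[ k ] P) × (d ⊢[ k ] negP P)

      ⊢₀-≋ : ∀ {d k P Q} → P ≋ Q → d ⊢₀[ k ] P → d ⊢₀[ k ] Q
      ⊢₀-≋ h (p , q) = ⊢-≋ h p , ⊢-≋ (scale-cong (- 1ℚ) h) q

      ⊢₀-mono : ∀ {d e k l P} → d ≤ e → k ≤ l → d ⊢₀[ k ] P → e ⊢₀[ l ] P
      ⊢₀-mono h l (p , q) = ⊢-mono h l p , ⊢-mono h l q

      ⊢₀-neg : ∀ {d k P} → d ⊢₀[ k ] P → d ⊢₀[ k ] negP P
      ⊢₀-neg {P = P} (p , q) = q , ⊢-≋ (≋-sym (negP-involutive P)) p

      ⊢₀-plus : ∀ {d k l P Q} → d ⊢₀[ k ] P → d ⊢₀[ l ] Q → d ⊢₀[ suc (k + l) ] P ++ Q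
      ⊢₀-plus {P = P} {Q} (p , p′) (q , q′) =
        ⊢-plus p q , ⊢-≋ (≡⇒≋ (sym (Listₚ.map-++ _ P Q))) (⊢-plus p′ q′)

      ⊢₀-var : ∀ {d k P} y → d ⊢₀[ k ] P → suc d ⊢₀[ suc k ] mulVar y P
      ⊢₀-var {P = P} y (p , q) = ⊢-var y p , ⊢-≋ (≡⇒≋ (trans (sym (Listₚ.map-∘ P)) (Listₚ.map-∘ P))) (⊢-var y q)

      -- With n = 0 the inequality 0 ≥ 0 is not derivable from the axioms alone.
      module _ (y₀ : Var n) (2≤w : 2 ≤ w) where

        ⊢₀-zero : ∀ {d} → 2 ≤ d → d ⊢₀[ 3 ] []
        ⊢₀-zero {d} 2≤d = z , z
          where
          B : Poly n
          B = (1ℚ , y₀ ∷ y₀ ∷ []) ∷ (- 1ℚ , y₀ ∷ []) ∷ []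
          B≤ : Deg d B
          B≤ = 2≤d ∷ ℕₚ.≤-trans (s≤s z≤n) 2≤d ∷ []
          B≤′ : Deg d (negP B)
          B≤′ = 2≤d ∷ ℕₚ.≤-trans (s≤s z≤n) 2≤d ∷ []
          z : d ⊢[ 3 ] []
          z = derives (plus (base (inj₂ (boolean y₀ B (λ _ → refl))) B≤ 2≤w)
                            (base (inj₂ (boolean⁻ y₀ (negP B) (λ _ → refl))) B≤′ 2≤w))
                      (negP-inverseʳ B) ℕₚ.≤-refl

        ⊢₀-scale : ∀ {d k P} c → 2 ≤ d → d ⊢₀[ k ] P → d ⊢₀[ 3 + k ] scale c P
        ⊢₀-scale {d} {k} {P} c 2≤d (p , q) with ℚₚ.<-cmp 0ℚ c
        ... | tri< 0<c _ _ = ⊢₀-mono ℕₚ.≤-refl (ℕₚ.m≤n+m _ 2)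
              (⊢-times c 0<c p , ⊢-≋ (scale-comm c (- 1ℚ) P) (⊢-times c 0<c q))
        ... | tri≈ _ refl _ = ⊢₀-≋ (≋-sym (scale-0 P)) (⊢₀-mono ℕₚ.≤-refl (ℕₚ.m≤m+n 3 k) (⊢₀-zero 2≤d))
        ... | tri> _ _ c<0 = ⊢₀-≋ eq (⊢₀-mono ℕₚ.≤-refl (ℕₚ.m≤n+m _ 2)
              (⊢-times (- c) 0<-c q , ⊢-≋ (≋-trans (scale-cong (- c) (≋-sym (negP-involutive P)))
                (scale-comm (- c) (- 1ℚ) (negP P))) (⊢-times (- c) 0<-c p)))
          where
          0<-c : 0ℚ <ℚ - c
          0<-c = ℚₚ.neg-antimono-< c<0
          eq : scale (- c) (negP P) ≋ scale c P
          eq = ≋-trans (scale-scale (- c) (- 1ℚ) P) (≡⇒≋ (cong (λ r → scale r P) (begin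
            (- c) *ℚ (- 1ℚ)   ≡⟨ ℚₚ.neg-distribˡ-* c (- 1ℚ) ⟨
            - (c *ℚ (- 1ℚ))   ≡⟨ cong -_ (ℚₚ.neg-distribʳ-* c 1ℚ) ⟨
            - (- (c *ℚ 1ℚ))   ≡⟨ ℚGroup.⁻¹-involutive (c *ℚ 1ℚ) ⟩
            c *ℚ 1ℚ           ≡⟨ ℚₚ.*-identityʳ c ⟩
            c                 ∎)))

        ⊢₀-mulTerm : ∀ {d k P} t → 2 ≤ d → d ⊢₀[ k ] P →
                     length (proj₂ t) + d ⊢₀[ length (proj₂ t) + (3 + k) ] mulTerm t P
        ⊢₀-mulTerm     (c , [])    2≤d p = ⊢₀-scale c 2≤d p
        ⊢₀-mulTerm {P = P} (c , y ∷ μ) 2≤d p = ⊢₀-≋ (≡⇒≋ (mulTerm-∷ c y μ P)) (⊢₀-var y (⊢₀-mulTerm (c , μ) 2≤d p))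

        -- Q is expanded into terms, each of which repeats the derivation of P. The final 3 pays for
        -- the empty sum, which has to be derived as 0 = 0 from a Boolean axiom; this is also where
        -- degree 2 is required.
        ⊢₀-⊗ : ∀ {d e k P Q} → 2 ≤ d → Deg e Q → d ⊢₀[ k ] P →
               e + d ⊢₀[ length Q * suc (e + (3 + k)) + 3 ] Q ⊗ P
        ⊢₀-⊗ {d} {e} 2≤d []      p = ⊢₀-zero (ℕₚ.≤-trans 2≤d (ℕₚ.m≤n+m d e))
        ⊢₀-⊗ {d} {e} {k} {Q = t ∷ Q} 2≤d (h ∷ hs) p = ⊢₀-mono ℕₚ.≤-refl
          (s≤s (ℕₚ.≤-reflexive (sym (ℕₚ.+-assoc (e + (3 + k)) (length Q * suc (e + (3 + k))) 3))))
          (⊢₀-plus (⊢₀-mono (ℕₚ.+-monoˡ-≤ d h) (ℕₚ.+-monoˡ-≤ (3 + k) h) (⊢₀-mulTerm t 2≤d p)) (⊢₀-⊗ 2≤d hs p))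

-- Case distinction on few variables

lit : ∀ {n} → Bool → Fin n → Var n
lit true  = inj₁
lit false = inj₂

-- As a product, this is the indicator of the assignment α on the listed variables, written ρ below:
-- on 0/1 points it is 1 where the point agrees with α on them and 0 elsewhere.
lits : ∀ {n} → (Fin n → Bool) → List (Fin n) → Monomial n
lits α = map (λ i → lit (α i) i)

bitℚ : Bool → ℚ
bitℚ true  = 1ℚ
bitℚ false = 0ℚ

iter : ℕ → (ℕ → ℕ) → ℕ → ℕ
iter zero    f k = k
iter (suc l) f k = iter l f (f k)

iter-mono : ∀ {l l′} (f : ℕ → ℕ) → (∀ k → k ≤ f k) → (∀ {j k} → j ≤ k → f j ≤ f k) → l ≤ l′ →
            ∀ {j k} → j ≤ k → iter l f j ≤ iter l′ f k
iter-mono f inc mon (s≤s h) p = iter-mono f inc mon h (mon p)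
iter-mono {l′ = zero} f inc mon z≤n p = p
iter-mono {l′ = suc l′} f inc mon z≤n p = iter-mono f inc mon (z≤n {l′}) (ℕₚ.≤-trans p (inc _))

-- The size of the tree built by `step`. The last argument of `iter` is one branch: three literals
-- on a premise, plus a product of at most g terms with an equation of cost k. Each of the three
-- merges doubles this and adds the twin equation times a polynomial of at most g terms, at 9 nodes
-- per term.
stepCost : ℕ → ℕ → ℕ
stepCost g k = iter 3 (λ j → suc (suc (j + j) + (g * 9 + 3))) (suc (4 + (g * (6 + k) + 3)))

-2ℚ : ℚ
-2ℚ = - (1ℚ +ℚ 1ℚ)

module _ {n : ℕ} where

  mono : Monomial n → Poly n
  mono μ = (1ℚ , μ) ∷ []

  linear : (Fin n → ℚ) → List (Fin n) → Poly n
  linear c = map (λ i → c i , inj₁ i ∷ [])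

  value : (Fin n → ℚ) → (Fin n → Bool) → List (Fin n) → ℚ
  value c α = foldr (λ i v → c i *ℚ bitℚ (α i) +ℚ v) 0ℚ

  -- (Λ + s)(Λ + s − 2) ≥ 0: the form Λ takes no value strictly between −s and 2 − s.
  gap : Poly n → ℚ → Poly n
  gap Λ s = (Λ ++ constP s) ⊗ ((Λ ++ constP s) ++ constP -2ℚ)

  gap-Deg : ∀ (Λ : Poly n) s → Deg 1 Λ → Deg 2 (gap Λ s)
  gap-Deg Λ s h = Deg-⊗ (Allₚ.++⁺ h (z≤n ∷ [])) (Allₚ.++⁺ (Allₚ.++⁺ h (z≤n ∷ [])) (z≤n ∷ []))

  ineqSum : Subset n → Subset n → List (Fin n) → Poly n
  ineqSum I T = foldr (λ i acc → if lookup I i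
    then ((if lookup T i then (1ℚ , inj₂ i ∷ []) else (1ℚ , inj₁ i ∷ [])) ∷ acc) else acc)
    ((- 1ℚ , []) ∷ [])

  constP-+ : ∀ a b → constP {n} (a +ℚ b) ≋ constP a ++ constP b
  constP-+ a b = mk λ μ → coeffs (sameMono [] μ)
    where
    coeffs : ∀ t → (if t then a +ℚ b else 0ℚ) +ℚ 0ℚ ≡ (if t then a else 0ℚ) +ℚ ((if t then b else 0ℚ) +ℚ 0ℚ)
    coeffs true  = ℚₚ.+-assoc a b 0ℚ
    coeffs false = refl

  ∷-0 : ∀ {μ} (P : Poly n) → ((0ℚ , μ) ∷ P) ≋ P
  ∷-0 {μ} P = mk λ ν → coeffs (sameMono μ ν) (coeff P ν)
    where
    coeffs : ∀ (t : Bool) r → (if t then 0ℚ else 0ℚ) +ℚ r ≡ r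
    coeffs true  r = ℚₚ.+-identityˡ r
    coeffs false r = ℚₚ.+-identityˡ r

  scale-constP : ∀ c (P : Poly n) → scale c P ≋ constP c ⊗ P
  scale-constP c P = ≡⇒≋ (sym (Listₚ.++-identityʳ (scale c P)))

  mono-∷ : ∀ y μ P → mulVar y (mono μ ⊗ P) ≋ mono (y ∷ μ) ⊗ P
  mono-∷ y μ P = ≡⇒≋ (trans (cong (mulVar y) (Listₚ.++-identityʳ (mulTerm (1ℚ , μ) P)))
    (trans (mulTerm-∷ 1ℚ y μ P) (sym (Listₚ.++-identityʳ _))))

  mono-⊗ : ∀ μ (P : Poly n) → mulTerm (1ℚ , μ) P ≋ mono μ ⊗ P
  mono-⊗ μ P = ≡⇒≋ (sym (Listₚ.++-identityʳ _))

  -1+1 : constP {n} 1ℚ ++ constP (- 1ℚ) ≋ []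
  -1+1 = negP-inverseʳ (constP 1ℚ)

  -- The value v of ℓ may be moved into the constant s, up to a multiple of ℓ − v.
  gap-shift : ∀ (ρ Λ ℓ : Poly n) s v →
    ρ ⊗ gap Λ (s +ℚ v)
      ++ (((Λ ++ constP s) ++ (Λ ++ constP s)) ++ (constP v ++ (constP -2ℚ ++ ℓ))) ⊗ (ρ ⊗ (ℓ ++ constP (- v)))
    ≋ ρ ⊗ gap (Λ ++ ℓ) s
  gap-shift ρ Λ ℓ s v =
    ≋-trans (++-cong (⊗-congˡ ρ (⊗-cong {P = Λ ++ constP (s +ℚ v)} {Q = (Λ ++ constP (s +ℚ v)) ++ constP -2ℚ}
        (++-cong {P = Λ} ≋-refl (constP-+ s v))
        (++-cong (++-cong {P = Λ} ≋-refl (constP-+ s v)) ≋-refl))) ≋-refl)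
    -- With f(z) = z(z - 2) and y = Λ + s, f(y + ℓ) - f(y + v) = (2y + v - 2 + ℓ)(ℓ - v), which
    -- explains the cofactor. The atom w is -v and r is -2.
    (≋-trans (solve 7 (λ ρ Λ ℓ s v w r →
        ρ :* ((Λ :+ (s :+ v)) :* ((Λ :+ (s :+ v)) :+ r))
          :+ (((Λ :+ s) :+ (Λ :+ s)) :+ (v :+ (r :+ ℓ))) :* (ρ :* (ℓ :+ w))
        := ρ :* (((Λ :+ ℓ) :+ s) :* (((Λ :+ ℓ) :+ s) :+ r))
          :+ (v :+ w) :* (ρ :* (((Λ :+ s) :+ (Λ :+ s)) :+ (v :+ (r :+ ℓ)))))
      ≋-refl ρ Λ ℓ (constP s) (constP v) (constP (- v)) (constP -2ℚ))
    (≋-trans (++-cong {P = ρ ⊗ gap (Λ ++ ℓ) s} ≋-refl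
        (⊗-cong {P′ = []} {Q = ρ ⊗ (((Λ ++ constP s) ++ (Λ ++ constP s)) ++ (constP v ++ (constP -2ℚ ++ ℓ)))} v-v ≋-refl))
      (≡⇒≋ (Listₚ.++-identityʳ _))))
    where
    open NatSolver (polySemiring n)
    v-v : constP {n} v ++ constP (- v) ≋ []
    v-v = ≋-trans (≋-sym (constP-+ v (- v))) (≋-trans (≡⇒≋ (cong constP (ℚₚ.+-inverseʳ v))) (∷-0 []))

  lits-update : ∀ (α : Fin n → Bool) {i} b is → All (λ j → i ≢ j) is → lits (updateAt α i (const b)) is ≡ lits α is
  lits-update α b []       []       = refl
  lits-update α {i} b (j ∷ is) (h ∷ hs) =
    cong₂ {A = Bool} {B = Monomial n} (λ b′ μ → lit b′ j ∷ μ) (updateAt-minimal j i α (λ e → h (sym e))) (lits-update α b is hs)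

  module _ (H : Poly n → Set) {w : ℕ} (3≤w : 3 ≤ w) {A : Poly n → Set} where

    2≤w : 2 ≤ w
    2≤w = ℕₚ.≤-trans (ℕₚ.n≤1+n 2) 3≤w

    infix 1 _⊩[_]_ _⊩₀[_]_
    _⊩[_]_ _⊩₀[_]_ : ℕ → ℕ → Poly n → Set
    d ⊩[ k ] P = Derives H w A d k P
    d ⊩₀[ k ] P = (d ⊩[ k ] P) × (d ⊩[ k ] negP P)

    ⊩-mono : ∀ {d k P} μ → d ⊩[ k ] P → length μ + d ⊩[ length μ + k ] mono μ ⊗ P
    ⊩-mono {P = P} []      p = ⊢-≋ H w (≋-sym (≡⇒≋ (⊗-identityˡ P))) p
    ⊩-mono {P = P} (y ∷ μ) p = ⊢-≋ H w (mono-∷ y μ P) (⊢-var H w y (⊩-mono μ p))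

    twin₀ : ∀ i → 1 ⊩₀[ 1 ] (varP (inj₁ i) ++ (varP (inj₂ i) ++ constP (- 1ℚ)))
    twin₀ i = derives (base (inj₂ (twin i _ λ _ → refl)) D 3≤w) ≋-refl ℕₚ.≤-refl
            , derives (base (inj₂ (twin⁻ i _ λ _ → refl)) D′ 3≤w) ≋-refl ℕₚ.≤-refl
      where
      P = varP (inj₁ i) ++ (varP (inj₂ i) ++ constP (- 1ℚ))
      D : Deg 1 P
      D = s≤s z≤n ∷ s≤s z≤n ∷ z≤n ∷ []
      D′ : Deg 1 (negP P)
      D′ = s≤s z≤n ∷ s≤s z≤n ∷ z≤n ∷ []

    boolean₀ : ∀ y → 2 ⊩₀[ 1 ] ((1ℚ , y ∷ y ∷ []) ∷ (- 1ℚ , y ∷ []) ∷ [])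
    boolean₀ y = derives (base (inj₂ (boolean y _ λ _ → refl)) D 2≤w) ≋-refl ℕₚ.≤-refl
               , derives (base (inj₂ (boolean⁻ y _ λ _ → refl)) D′ 2≤w) ≋-refl ℕₚ.≤-refl
      where
      P = (1ℚ , y ∷ y ∷ []) ∷ (- 1ℚ , y ∷ []) ∷ []
      D : Deg 2 P
      D = ℕₚ.≤-refl ∷ s≤s z≤n ∷ []
      D′ : Deg 2 (negP P)
      D′ = ℕₚ.≤-refl ∷ s≤s z≤n ∷ []

    one₊ : 0 ⊩[ 1 ] constP 1ℚ
    one₊ = derives (base (inj₂ (one _ λ _ → refl)) (z≤n ∷ []) (ℕₚ.≤-trans (s≤s z≤n) 3≤w)) ≋-refl ℕₚ.≤-refl

    module _ (y₀ : Var n) where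

      -- Subtracting X + X̄ - 1 = 0, multiplied by `mono μ ⊗ P`, from the sum of the branches
      -- removes the literal. The degree 6 is 2 + 2 for the multiplier plus 2 for the twin equation,
      -- raised from degree 1 to the least degree that `⊢₀-⊗` accepts.
      cases : ∀ {k μ i P} → length μ ≤ 2 → Deg 2 P →
        6 ⊩[ k ] mono (inj₁ i ∷ μ) ⊗ P → 6 ⊩[ k ] mono (inj₂ i ∷ μ) ⊗ P →
        6 ⊩[ suc (suc (k + k) + (length P * 9 + 3)) ] mono μ ⊗ P
      cases {k} {μ} {i} {P} μ≤2 P≤2 p q = ⊢-≋ H w eq
        (⊢-plus H w (⊢-plus H w p q)
          (⊢-≋ H w (⊗-congˡ (mono μ ⊗ P) (scale-constP (- 1ℚ) Tw))
            (⊢-mono H w ℕₚ.≤-refl (ℕₚ.≤-reflexive (cong (λ l → l * 9 + 3) lenR))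
              (proj₁ (⊢₀-⊗ H w y₀ 2≤w ℕₚ.≤-refl R≤4 (⊢₀-neg H w (⊢₀-mono H w (ℕₚ.n≤1+n 1) ℕₚ.≤-refl (twin₀ i))))))))
        where
        Tw = varP (inj₁ i) ++ (varP (inj₂ i) ++ constP (- 1ℚ))
        R≤4 : Deg 4 (mono μ ⊗ P)
        R≤4 = Deg-⊗ {d = 2} {e = 2} {P = mono μ} (μ≤2 ∷ []) P≤2
        lenR : length (mono μ ⊗ P) ≡ length P
        lenR = trans (length-⊗ (mono μ) P) (ℕₚ.*-identityˡ _)
        open NatSolver (polySemiring n)
        x = varP (inj₁ i)
        x̄ = varP (inj₂ i)
        u = constP {n} (- 1ℚ)
        eq : (mono (inj₁ i ∷ μ) ⊗ P ++ mono (inj₂ i ∷ μ) ⊗ P) ++ (mono μ ⊗ P) ⊗ (u ⊗ Tw) ≋ mono μ ⊗ P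
        eq = ≋-trans (solve 5 (λ m P x x̄ u →
               (((x :* m) :* P :+ (x̄ :* m) :* P) :+ (m :* P) :* (u :* (x :+ (x̄ :+ u))))
               := (con 1 :+ u) :* ((x :+ x̄) :* (m :* P)) :+ (u :* u) :* (m :* P))
             ≋-refl (mono μ) P x x̄ u)
          (≋-trans (++-cong (⊗-cong {Q = (x ++ x̄) ⊗ (mono μ ⊗ P)} -1+1 ≋-refl) ≋-refl)
            -- `u ⊗ u` evaluates to `constP 1ℚ`.
            (≡⇒≋ (⊗-identityˡ (mono μ ⊗ P))))

      splitCost : Poly n → ℕ → ℕ
      splitCost P k = suc (suc (k + k) + (length P * 9 + 3))

      split : ∀ {k P} is → Unique is → length is ≤ 3 → Deg 2 P →
        (∀ α → 6 ⊩[ k ] mono (lits α is) ⊗ P) → 6 ⊩[ iter (length is) (splitCost P) k ] P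
      -- The empty product does not depend on α, so any assignment serves.
      split {P = P} [] _ _ _ f = ⊢-≋ H w (≡⇒≋ (⊗-identityˡ P)) (f (λ _ → false))
      split {k} {P} (i ∷ is) (i∉ ∷ u) (s≤s h) P≤2 f = split is u (ℕₚ.≤-trans h (ℕₚ.n≤1+n 2)) P≤2
        (λ α → cases (subst (_≤ 2) (sym (Listₚ.length-map _ is)) h) P≤2 (branch α true) (branch α false))
        where
        -- Assignments are total, so a branch on i overwrites α at i; since i does not recur in
        -- `is`, the remaining literals are unchanged.
        branch : ∀ α b → 6 ⊩[ k ] mono (lit b i ∷ lits α is) ⊗ P
        branch α b = subst₂ (λ b′ μ → 6 ⊩[ k ] mono (lit b′ i ∷ μ) ⊗ P)
          (updateAt-updates i α) (lits-update α b is i∉) (f (updateAt α i (const b)))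

      split≤3 : ∀ {k P} is → Unique is → length is ≤ 3 → Deg 2 P →
        (∀ α → 6 ⊩[ k ] mono (lits α is) ⊗ P) → 6 ⊩[ iter 3 (splitCost P) k ] P
      split≤3 {k} {P} is u h P≤2 f = ⊢-mono H w ℕₚ.≤-refl
        (iter-mono (splitCost P) (λ j → ℕₚ.m≤n⇒m≤1+n (ℕₚ.m≤n⇒m≤1+n (ℕₚ.≤-trans (ℕₚ.m≤m+n j j) (ℕₚ.m≤m+n _ _))))
          (λ p → s≤s (s≤s (ℕₚ.+-monoˡ-≤ _ (ℕₚ.+-mono-≤ p p)))) h ℕₚ.≤-refl)
        (split is u h P≤2 f)

      -- X X̄ = X(X + X̄ - 1) - (X² - X).
      conflict : ∀ b i → 2 ⊩₀[ 4 ] mono (lit b i ∷ lit (not b) i ∷ [])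
      conflict true i = ⊢₀-≋ H w eq (⊢₀-plus H w (⊢₀-var H w (inj₁ i) (twin₀ i)) (⊢₀-neg H w (boolean₀ (inj₁ i))))
        where
        x = inj₁ i
        x̄ = inj₂ i
        B : Poly n
        B = (1ℚ , x ∷ x ∷ []) ∷ (- 1ℚ , x ∷ []) ∷ []
        eq : mulVar x (varP x ++ (varP x̄ ++ constP (- 1ℚ))) ++ negP B ≋ mono (x ∷ x̄ ∷ [])
        eq = ≋-trans (++-cong {P = mulVar x (varP x ++ (varP x̄ ++ constP (- 1ℚ)))} {P′ = mono (x ∷ x̄ ∷ []) ++ B} {Q = negP B}
                (++-swap (mono (x ∷ x ∷ [])) (mono (x ∷ x̄ ∷ [])) ((- 1ℚ , x ∷ []) ∷ [])) ≋-refl)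
              (++-cong {P = mono (x ∷ x̄ ∷ [])} ≋-refl (negP-inverseʳ B))
      conflict false i = ⊢₀-≋ H w (∷-~ 1ℚ [] (++-comm~ (inj₁ i ∷ []) (inj₂ i ∷ []))) (conflict true i)

      -- For a true literal this is X² - X = 0, for a false one X̄ X = 0 with a zero constant. It is
      -- the reason why a variable acts as a constant once its literal is a factor.
      literal : ∀ b i → 2 ⊩₀[ 4 ] mono (lit b i ∷ []) ⊗ (varP (inj₁ i) ++ constP (- bitℚ b))
      literal true  i = ⊢₀-mono H w ℕₚ.≤-refl (s≤s z≤n) (boolean₀ (inj₁ i))
      literal false i = ⊢₀-≋ H w (++-cong {P = mono (inj₂ i ∷ inj₁ i ∷ [])} ≋-refl (≋-sym (∷-0 []))) (conflict false i)

      inContext : ∀ {k Q} α {i} is → i ∈ is → 2 ⊩₀[ k ] mono (lit (α i) i ∷ []) ⊗ Q →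
                  suc (length is) ⊩₀[ length is + (3 + k) ] mono (lits α is) ⊗ Q
      inContext {k} {Q} α {i} (i ∷ is) (here refl) p =
        ⊢₀-≋ H w (≋-trans (≋-trans (mono-⊗ μ (mono (y ∷ []) ⊗ Q)) (≡⇒≋ (sym (⊗-assoc (mono μ) (mono (y ∷ [])) Q))))
                    (⊗-cong {P = mono (μ ++ y ∷ [])} {Q = Q} (∷-~ 1ℚ [] (++-comm~ μ (y ∷ []))) ≋-refl))
          (⊢₀-mono H w (ℕₚ.≤-reflexive (trans (cong (_+ 2) lenμ) (ℕₚ.+-comm (length is) 2)))
            (ℕₚ.≤-trans (ℕₚ.≤-reflexive (cong (_+ (3 + k)) lenμ)) (ℕₚ.n≤1+n _))
            (⊢₀-mulTerm H w y₀ 2≤w (1ℚ , μ) ℕₚ.≤-refl p))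
        where
        μ = lits α is
        y = lit (α i) i
        lenμ : length μ ≡ length is
        lenμ = Listₚ.length-map _ is
      inContext {Q = Q} α (j ∷ is) (there m) p =
        ⊢₀-≋ H w (mono-∷ (lit (α j) j) (lits α is) Q) (⊢₀-var H w (lit (α j) j) (inContext α is m p))

      module _ (α : Fin n → Bool) (is : List (Fin n)) (is≤3 : length is ≤ 3) where

        inContext₃ : ∀ {Q i} → i ∈ is → 2 ⊩₀[ 4 ] mono (lit (α i) i ∷ []) ⊗ Q → 4 ⊩₀[ 10 ] mono (lits α is) ⊗ Q
        inContext₃ m p = ⊢₀-mono H w (s≤s is≤3) (ℕₚ.+-monoˡ-≤ 7 is≤3) (inContext α is m p)

        zero₄ : 4 ⊩₀[ 3 ] []
        zero₄ = ⊢₀-zero H w y₀ 2≤w (s≤s (s≤s z≤n))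

        -- Each term c X may be replaced by its value, because the literal of X is a factor of ρ.
        -- Variables outside `is` are harmless when their coefficient is 0, so forms can be written
        -- over all n variables.
        linear-value : ∀ c xs → All (λ i → c i ≡ 0ℚ ⊎ i ∈ is) xs →
          4 ⊩₀[ length xs * 14 + 3 ] mono (lits α is) ⊗ (linear c xs ++ constP (- value c α xs))
        linear-value c [] [] = ⊢₀-≋ H w (≋-sym eq) zero₄
          where
          eq : mono (lits α is) ⊗ constP (- 0ℚ) ≋ []
          eq = ∷-0 []
        linear-value c (i ∷ xs) (s ∷ ss) = ⊢₀-≋ H w eq (⊢₀-plus H w (term s) (linear-value c xs ss))
          where
          open NatSolver (polySemiring n)
          β = bitℚ (α i)
          term : c i ≡ 0ℚ ⊎ i ∈ is → 4 ⊩₀[ 13 ] constP (c i) ⊗ (mono (lits α is) ⊗ (varP (inj₁ i) ++ constP (- β)))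
          term (inj₁ h) = ⊢₀-≋ H w
            (≋-sym (⊗-cong {Q = mono (lits α is) ⊗ (varP (inj₁ i) ++ constP (- β))} (≋-trans (≡⇒≋ (cong constP h)) (∷-0 [])) ≋-refl))
            (⊢₀-mono H w ℕₚ.≤-refl (s≤s (s≤s (s≤s z≤n))) zero₄)
          term (inj₂ m) = ⊢₀-≋ H w (scale-constP (c i) (mono (lits α is) ⊗ (varP (inj₁ i) ++ constP (- β))))
            (⊢₀-scale H w y₀ 2≤w (c i) (s≤s (s≤s z≤n)) (inContext₃ {Q = varP (inj₁ i) ++ constP (- β)} m (literal (α i) i)))
          -cβ : constP {n} (c i) ⊗ constP (- β) ≋ constP (- (c i *ℚ β))
          -cβ = ≡⇒≋ (cong constP (sym (ℚₚ.neg-distribʳ-* (c i) β)))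
          cx : constP (c i) ⊗ varP (inj₁ i) ≋ (c i , inj₁ i ∷ []) ∷ []
          cx = ≡⇒≋ (cong (λ d → (d , inj₁ i ∷ []) ∷ []) (ℚₚ.*-identityʳ (c i)))
          neg-sum : constP {n} (- (c i *ℚ β +ℚ value c α xs)) ≋ constP (- (c i *ℚ β)) ++ constP (- value c α xs)
          neg-sum = ≋-trans (≡⇒≋ (cong constP (ℚₚ.neg-distrib-+ (c i *ℚ β) (value c α xs)))) (constP-+ (- (c i *ℚ β)) (- value c α xs))
          eq : constP (c i) ⊗ (mono (lits α is) ⊗ (varP (inj₁ i) ++ constP (- β)))
                 ++ mono (lits α is) ⊗ (linear c xs ++ constP (- value c α xs))
               ≋ mono (lits α is) ⊗ (linear c (i ∷ xs) ++ constP (- value c α (i ∷ xs)))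
          eq = ≋-trans (solve 6 (λ c m x b l v → c :* (m :* (x :+ b)) :+ m :* (l :+ v)
                           := m :* ((c :* x :+ l) :+ (c :* b :+ v)))
                         ≋-refl (constP (c i)) (mono (lits α is)) (varP (inj₁ i)) (constP (- β)) (linear c xs) (constP (- value c α xs)))
              (⊗-congˡ (mono (lits α is)) (++-cong {P = constP (c i) ⊗ varP (inj₁ i) ++ linear c xs}
                (++-cong {Q = linear c xs} cx ≋-refl)
                (≋-trans (++-cong {Q = constP (- value c α xs)} -cβ ≋-refl) (≋-sym neg-sum))))

        module _ (I T : Subset n) (I⊆is : ∀ i → lookup I i ≡ true → i ∈ is)
                 (T≡α : ∀ i → lookup I i ≡ true → lookup T i ≡ α i) where

          -- As T agrees with α on I, every summand of the inequality is the literal that α makes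
          -- false. Its product with ρ vanishes by `conflict`, and only the constant -1 is left.
          ineqSum-value : ∀ xs → 4 ⊩₀[ length xs * 14 + 3 ] mono (lits α is) ⊗ (ineqSum I T xs ++ constP 1ℚ)
          ineqSum-value [] = ⊢₀-≋ H w (≋-trans (≋-sym (≡⇒≋ (⊗-zeroʳ (mono (lits α is))))) (⊗-congˡ (mono (lits α is)) {Q = []}
              (≋-sym (≋-trans (++-comm (constP (- 1ℚ)) (constP 1ℚ)) -1+1)))) zero₄
          ineqSum-value (i ∷ xs) with lookup I i in eqI
          ... | false = ⊢₀-mono H w ℕₚ.≤-refl (ℕₚ.m≤n+m _ 14) (ineqSum-value xs)
          ... | true rewrite T≡α i eqI = ⊢₀-mono H w ℕₚ.≤-refl (s≤s (ℕₚ.m≤n+m _ 3))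
                (⊢₀-≋ H w (≋-trans (≋-sym (eq (varP (lit (not (α i)) i)) (ineqSum I T xs ++ constP 1ℚ)))
                    (⊗-congˡ (mono (lits α is)) (≡⇒≋ (false-literal (α i)))))
                  (⊢₀-plus H w (inContext₃ {Q = varP (lit (not (α i)) i)} (I⊆is i eqI) (conflict (α i) i)) (ineqSum-value xs)))
            where
            false-literal : ∀ b → (varP (lit (not b) i) ++ (ineqSum I T xs ++ constP 1ℚ)) ≡
              ((if b then (1ℚ , inj₂ i ∷ []) else (1ℚ , inj₁ i ∷ [])) ∷ ineqSum I T xs) ++ constP 1ℚ
            false-literal true  = refl
            false-literal false = refl
            open NatSolver (polySemiring n)
            eq : ∀ x R → mono (lits α is) ⊗ (x ++ R) ≋ mono (lits α is) ⊗ x ++ mono (lits α is) ⊗ R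
            eq x R = solve 3 (λ m x r → m :* (x :+ r) := m :* x :+ m :* r) ≋-refl (mono (lits α is)) x R

          -- From P ≥ 0 follows ρP ≥ 0, and ρ(P + 1) = 0, so -ρ ≥ 0; the other sign is 1 ≥ 0
          -- multiplied by the literals. From ρ = 0 any multiple of ρ follows.
          falsified : 1 ⊩[ 1 ] ineqPoly I T → 4 ⊩₀[ length (allFin n) * 14 + 8 ] mono (lits α is)
          falsified h =
              ⊢-≋ H w (∷-1 (lits α is)) (⊢-mono H w (bound 1 (s≤s z≤n)) (cost 4 (ℕₚ.+-monoˡ-≤ 1 len≤) (s≤s (s≤s (s≤s (s≤s z≤n)))))
                (⊩-mono {d = 1} (lits α is) (⊢-mono H w (z≤n {1}) ℕₚ.≤-refl one₊)))
            , ⊢-≋ H w eq (⊢-mono H w ℕₚ.≤-refl lem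
                (⊢-plus H w (⊢-mono H w (bound 1 ℕₚ.≤-refl) (ℕₚ.+-monoˡ-≤ 1 len≤) (⊩-mono (lits α is) h)) (proj₂ (ineqSum-value (allFin n)))))
            where
            len≤ : length (lits α is) ≤ 3
            len≤ = subst (_≤ 3) (sym (Listₚ.length-map _ is)) is≤3
            bound : ∀ d → d ≤ 1 → length (lits α is) + d ≤ 4
            bound d d≤1 = ℕₚ.+-mono-≤ len≤ d≤1
            cost : ∀ {j} l → j ≤ l → l ≤ 8 → j ≤ length (allFin n) * 14 + 8
            cost l p q = ℕₚ.≤-trans p (ℕₚ.≤-trans q (ℕₚ.m≤n+m 8 _))
            lem : suc (4 + (length (allFin n) * 14 + 3)) ≤ length (allFin n) * 14 + 8
            lem = ℕₚ.≤-reflexive (trans (ℕₚ.+-comm 5 _) (ℕₚ.+-assoc (length (allFin n) * 14) 3 5))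
            ∷-1 : ∀ μ → mono μ ⊗ constP 1ℚ ≋ mono μ
            ∷-1 μ = ≡⇒≋ (cong (λ ν → mono ν) (Listₚ.++-identityʳ μ))
            open NatSolver (polySemiring n)
            P = ineqPoly I T
            u = constP {n} (- 1ℚ)
            m = mono (lits α is)
            eq : m ⊗ P ++ negP (m ⊗ (P ++ constP 1ℚ)) ≋ negP m
            eq = ≋-trans (++-cong {P = m ⊗ P} ≋-refl (scale-constP (- 1ℚ) (m ⊗ (P ++ constP 1ℚ))))
              (≋-trans (solve 3 (λ m p u → m :* p :+ u :* (m :* (p :+ con 1)) := (con 1 :+ u) :* (m :* p) :+ u :* m) ≋-refl m P u)
              (≋-trans (++-cong {Q = u ⊗ m} (⊗-cong {Q = m ⊗ P} -1+1 ≋-refl) ≋-refl) (≋-sym (scale-constP (- 1ℚ) m))))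

      -- Common to adding an equation and to removing a variable, which differ only in ℓ. A
      -- contradictory branch multiplies ρ = 0, of degree 4, by the gap of degree 2, which gives 6.
      -- In the other branches `gap-shift` needs only 3 + 2 for the premise and 1 + 4 for the
      -- correction.
      step : ∀ {g k} Λ ℓ s is → Deg 1 Λ → Deg 1 ℓ → Unique is → length is ≤ 3 →
        length (gap (Λ ++ ℓ) s) ≤ g → suc (suc (length Λ + length Λ + suc (suc (length ℓ)))) ≤ g →
        (∀ α → (4 ⊩₀[ k ] mono (lits α is)) ⊎
               Σ ℚ λ v → (4 ⊩₀[ k ] mono (lits α is) ⊗ (ℓ ++ constP (- v))) × (2 ⊩[ 1 ] gap Λ (s +ℚ v))) →
        6 ⊩[ stepCost g k ] gap (Λ ++ ℓ) s
      step {g} {k} Λ ℓ s is Λ≤1 ℓ≤1 u is≤3 G≤g K≤g f = ⊢-mono H w ℕₚ.≤-refl mon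
        (split≤3 is u is≤3 G≤2 (λ α → branch α (f α)))
        where
        G = gap (Λ ++ ℓ) s
        G≤2 : Deg 2 G
        G≤2 = gap-Deg (Λ ++ ℓ) s (Allₚ.++⁺ Λ≤1 ℓ≤1)
        K : ℚ → Poly n
        K v = ((Λ ++ constP s) ++ (Λ ++ constP s)) ++ (constP v ++ (constP -2ℚ ++ ℓ))
        K≤1 : ∀ v → Deg 1 (K v)
        K≤1 v = Allₚ.++⁺ (Allₚ.++⁺ (Allₚ.++⁺ Λ≤1 (z≤n ∷ [])) (Allₚ.++⁺ Λ≤1 (z≤n ∷ []))) (z≤n ∷ z≤n ∷ ℓ≤1)
        lenK : ∀ v → length (K v) ≤ g
        lenK v = ℕₚ.≤-trans (ℕₚ.≤-reflexive (begin
          length (K v) ≡⟨ Listₚ.length-++ ((Λ ++ constP s) ++ (Λ ++ constP s)) ⟩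
          length ((Λ ++ constP s) ++ (Λ ++ constP s)) + l ≡⟨ cong (_+ l) (Listₚ.length-++ (Λ ++ constP s)) ⟩
          length (Λ ++ constP s) + length (Λ ++ constP s) + l
            ≡⟨ cong (λ a → a + a + l) (trans (Listₚ.length-++ Λ) (ℕₚ.+-comm (length Λ) 1)) ⟩
          suc (length Λ + suc (length Λ)) + l ≡⟨ cong (λ a → suc a + l) (ℕₚ.+-suc (length Λ) (length Λ)) ⟩
          suc (suc (length Λ + length Λ + l)) ∎)) K≤g
          where l = suc (suc (length ℓ))
        mon : iter 3 (splitCost G) (suc (4 + (g * (6 + k) + 3))) ≤ stepCost g k
        mon = iter3-mono
          where
          k₀ = suc (4 + (g * (6 + k) + 3))
          f≤ : ∀ {i j} → i ≤ j → splitCost G i ≤ suc (suc (j + j) + (g * 9 + 3))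
          f≤ p = s≤s (s≤s (ℕₚ.+-mono-≤ (ℕₚ.+-mono-≤ p p) (ℕₚ.+-monoˡ-≤ 3 (ℕₚ.*-monoˡ-≤ 9 G≤g))))
          iter3-mono = f≤ {splitCost G (splitCost G k₀)} (f≤ {splitCost G k₀} (f≤ {k₀} ℕₚ.≤-refl))
        branch : ∀ α → (4 ⊩₀[ k ] mono (lits α is)) ⊎
               Σ ℚ (λ v → (4 ⊩₀[ k ] mono (lits α is) ⊗ (ℓ ++ constP (- v))) × (2 ⊩[ 1 ] gap Λ (s +ℚ v))) →
               6 ⊩[ suc (4 + (g * (6 + k) + 3)) ] mono (lits α is) ⊗ G
        branch α (inj₁ e) = ⊢-≋ H w (⊗-comm G (mono (lits α is))) (⊢-mono H w ℕₚ.≤-refl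
          (ℕₚ.≤-trans (ℕₚ.+-monoˡ-≤ 3 (ℕₚ.*-monoˡ-≤ (6 + k) G≤g)) (ℕₚ.m≤n+m _ 5))
          (proj₁ (⊢₀-⊗ H w y₀ 2≤w (s≤s (s≤s z≤n)) G≤2 e)))
        branch α (inj₂ (v , e , p)) = ⊢-≋ H w (gap-shift (mono (lits α is)) Λ ℓ s v) (⊢-plus H w
          (⊢-mono H w (ℕₚ.+-mono-≤ len≤ (ℕₚ.m≤n+m 2 1)) (ℕₚ.+-monoˡ-≤ 1 len≤) (⊩-mono (lits α is) p))
          (⊢-mono H w (ℕₚ.n≤1+n 5) (ℕₚ.+-monoˡ-≤ 3 (ℕₚ.*-mono-≤ (lenK v) (ℕₚ.n≤1+n _)))
            (proj₁ (⊢₀-⊗ H w y₀ 2≤w (s≤s (s≤s z≤n)) (K≤1 v) e))))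
          where
          len≤ : length (lits α is) ≤ 3
          len≤ = subst (_≤ 3) (sym (Listₚ.length-map _ is)) is≤3

-- Linear algebra over ℤ₂

odd : ℕ → Bool
odd zero    = false
odd (suc k) = not (odd k)

odd-+ : ∀ j k → odd (j + k) ≡ odd j xor odd k
odd-+ zero    k = refl
odd-+ (suc j) k = trans (cong not (odd-+ j k)) (not-xor (odd j) (odd k))
  where
  not-xor : ∀ x y → not (x xor y) ≡ not x xor y
  not-xor true  y = Boolₚ.not-involutive y
  not-xor false y = refl

odd-% : ∀ k → k % 2 ≡ bitℕ (odd k)
odd-% zero          = refl
odd-% (suc zero)    = refl
odd-% (suc (suc k)) = trans (odd-% k) (cong bitℕ (sym (Boolₚ.not-involutive (odd k))))

odd-bitℕ : ∀ x → odd (bitℕ x) ≡ x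
odd-bitℕ true  = refl
odd-bitℕ false = refl

dot : ∀ {n} → Vec Bool n → Vec Bool n → Bool
dot []      []      = false
dot (x ∷ a) (h ∷ v) = (h ∧ x) xor dot a v

infixl 6 _⊞_
_⊞_ : ∀ {n} → Vec Bool n → Vec Bool n → Vec Bool n
_⊞_ = zipWith _xor_

dot-⊞ : ∀ {n} (a u v : Vec Bool n) → dot a (u ⊞ v) ≡ dot a u xor dot a v
dot-⊞ []      []      []      = refl
dot-⊞ (x ∷ a) (g ∷ u) (h ∷ v) = trans (cong (((g xor h) ∧ x) xor_) (dot-⊞ a u v))
  (solve 5 (λ g h x p q → (g :+ h) :* x :+ (p :+ q) := (g :* x :+ p) :+ (h :* x :+ q)) refl g h x (dot a u) (dot a v))
  where open xor-∧-Solver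

dot-∩ : ∀ {n} (a v : Vec Bool n) → dot a v ≡ odd ∣ v ∩ a ∣
dot-∩ []          []          = refl
dot-∩ (x ∷ a)     (false ∷ v) = dot-∩ a v
dot-∩ (false ∷ a) (true ∷ v)  = dot-∩ a v
dot-∩ (true ∷ a)  (true ∷ v)  = cong not (dot-∩ a v)

Row : ℕ → Set
Row n = Vec Bool n × Bool

Solves : ∀ {n} → Vec Bool n → Row n → Set
Solves a (v , c) = dot a v ≡ c

-- Gaussian elimination: D is any class of equations closed under addition.
solvable-or-contradiction : ∀ n (D : Vec Bool n → Bool → Set) →
  (∀ {u v b c} → D u b → D v c → D (u ⊞ v) (b xor c)) →
  (rs : List (Row n)) → All (λ r → D (proj₁ r) (proj₂ r)) rs →
  (Σ (Vec Bool n) λ a → All (Solves a) rs) ⊎ D (replicate n false) true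
solvable-or-contradiction zero D D+ [] [] = inj₁ ([] , [])
solvable-or-contradiction zero D D+ (([] , true) ∷ rs) (d ∷ ds) = inj₂ d
solvable-or-contradiction zero D D+ (([] , false) ∷ rs) (d ∷ ds) with solvable-or-contradiction zero D D+ rs ds
... | inj₁ ([] , h) = inj₁ ([] , refl ∷ h)
... | inj₂ e        = inj₂ e
solvable-or-contradiction (suc n) D D+ rs ds = eliminate (findPivot rs ds)
  where
  D′ : Vec Bool n → Bool → Set
  D′ v = D (false ∷ v)

  findPivot : ∀ rs → All (λ r → D (proj₁ r) (proj₂ r)) rs →
    (Σ (Vec Bool n) λ p → Σ Bool λ c → D (true ∷ p) c) ⊎ All (λ r → lookup (proj₁ r) zero ≡ false) rs
  findPivot []                    []       = inj₂ []
  findPivot ((true ∷ p , c) ∷ rs) (d ∷ ds) = inj₁ (p , c , d)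
  findPivot ((false ∷ v , c) ∷ rs) (d ∷ ds) with findPivot rs ds
  ... | inj₁ p = inj₁ p
  ... | inj₂ h = inj₂ (refl ∷ h)

  reduce : Vec Bool n → Bool → Row (suc n) → Row n
  reduce p c (false ∷ v , d) = v , d
  reduce p c (true ∷ v , d)  = v ⊞ p , d xor c

  solve-pivot : ∀ x y c d → y xor x ≡ d xor c → (x xor c) xor y ≡ d
  solve-pivot x y c d h = begin
    (x xor c) xor y ≡⟨ solve 3 (λ x y c → (x :+ c) :+ y := (y :+ x) :+ c) refl x y c ⟩
    (y xor x) xor c ≡⟨ cong (_xor c) h ⟩
    (d xor c) xor c ≡⟨ Boolₚ.xor-assoc d c c ⟩
    d xor (c xor c) ≡⟨ cong (d xor_) (Boolₚ.xor-same c) ⟩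
    d xor false     ≡⟨ Boolₚ.xor-identityʳ d ⟩
    d               ∎
    where open xor-∧-Solver

  solve-row : ∀ p c a r → Solves a (reduce p c r) → Solves ((dot a p xor c) ∷ a) r
  solve-row p c a (false ∷ v , d) h = h
  solve-row p c a (true ∷ v , d)  h = solve-pivot (dot a p) (dot a v) c d (trans (sym (dot-⊞ a v p)) h)

  eliminate : (Σ (Vec Bool n) λ p → Σ Bool λ c → D (true ∷ p) c) ⊎ All (λ r → lookup (proj₁ r) zero ≡ false) rs →
    (Σ (Vec Bool (suc n)) λ a → All (Solves a) rs) ⊎ D (replicate (suc n) false) true
  eliminate (inj₁ (p , c , d)) with solvable-or-contradiction n D′ D+ (map (reduce p c) rs) (Allₚ.map⁺ (All.map reduced ds))
    where
    reduced : ∀ {r} → D (proj₁ r) (proj₂ r) → D′ (proj₁ (reduce p c r)) (proj₂ (reduce p c r))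
    reduced {false ∷ v , e} d′ = d′
    reduced {true ∷ v , e}  d′ = D+ d′ d
  ... | inj₂ e       = inj₂ e
  ... | inj₁ (a , h) = inj₁ ((dot a p xor c) ∷ a , All.map (λ {r} → solve-row p c a r) (Allₚ.map⁻ h))
  eliminate (inj₂ nopivot) with solvable-or-contradiction n D′ D+ (map (λ r → Vec.tail (proj₁ r) , proj₂ r) rs)
                                  (Allₚ.map⁺ (All.zipWith (λ {r} → tails {r}) (ds , nopivot)))
    where
    tails : ∀ {r} → D (proj₁ r) (proj₂ r) × lookup (proj₁ r) zero ≡ false → D′ (Vec.tail (proj₁ r)) (proj₂ r)
    tails {false ∷ v , e} (d , _) = d
  ... | inj₂ e       = inj₂ e
  -- No row contains the variable, so its value is arbitrary.
  ... | inj₁ (a , h) = inj₁ (false ∷ a , All.zipWith (λ {r} → extend {r}) (Allₚ.map⁻ h , nopivot))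
    where
    extend : ∀ {r} → Solves a (Vec.tail (proj₁ r) , proj₂ r) × lookup (proj₁ r) zero ≡ false → Solves (false ∷ a) r
    extend {false ∷ v , e} (s , _) = s

xorSum : ∀ {m} → (Fin m → Bool) → Bool
xorSum {zero}  f = false
xorSum {suc m} f = f zero xor xorSum (f ∘ suc)

xorSum-xor : ∀ {m} (f g : Fin m → Bool) → xorSum (λ j → f j xor g j) ≡ xorSum f xor xorSum g
xorSum-xor {zero}  f g = refl
xorSum-xor {suc m} f g = trans (cong ((f zero xor g zero) xor_) (xorSum-xor (f ∘ suc) (g ∘ suc)))
  (solve 4 (λ a b c d → (a :+ b) :+ (c :+ d) := (a :+ c) :+ (b :+ d)) refl
    (f zero) (g zero) (xorSum (f ∘ suc)) (xorSum (g ∘ suc)))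
  where open xor-∧-Solver

xorSum-cong : ∀ {m} {f g : Fin m → Bool} → (∀ j → f j ≡ g j) → xorSum f ≡ xorSum g
xorSum-cong {zero}  h = refl
xorSum-cong {suc m} h = cong₂ _xor_ (h zero) (xorSum-cong (h ∘ suc))

δ : ∀ {m} → Fin m → Fin m → Bool
δ zero    zero    = true
δ zero    (suc k) = false
δ (suc j) zero    = false
δ (suc j) (suc k) = δ j k

xorSum-δ : ∀ {m} (j : Fin m) (f : Fin m → Bool) → xorSum (λ k → δ j k ∧ f k) ≡ f j
xorSum-δ {suc m} zero f = trans (cong (f zero xor_) (xorSum-false m)) (Boolₚ.xor-identityʳ (f zero))
  where
  xorSum-false : ∀ m → xorSum {m} (λ _ → false) ≡ false
  xorSum-false zero    = refl
  xorSum-false (suc m) = xorSum-false m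
xorSum-δ (suc j) f = xorSum-δ j (f ∘ suc)

-- Elimination is applied to the class D of sums of subfamilies J of the equations; it is closed
-- under addition because subfamilies combine by symmetric difference. The equation 0 = 1 in D
-- yields J.
contradictory-sum : ∀ {n m} (𝔼 : Instance n m) → Unsatisfiable 𝔼 →
  Σ (Fin m → Bool) λ J → (∀ i → xorSum (λ j → J j ∧ lookup (I (𝔼 j)) i) ≡ false)
                       × xorSum (λ j → J j ∧ b (𝔼 j)) ≡ true
contradictory-sum {n} {m} 𝔼 unsat
  with solvable-or-contradiction n D (λ {u} {v} {c} {d} → D+ {u} {v} {c} {d}) 
         (map (λ j → I (𝔼 j) , b (𝔼 j)) (allFin m)) (Allₚ.map⁺ (All.universal basis (allFin m)))
  where
  D : Vec Bool n → Bool → Set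
  D v c = Σ (Fin m → Bool) λ J → (∀ i → xorSum (λ j → J j ∧ lookup (I (𝔼 j)) i) ≡ lookup v i)
                               × xorSum (λ j → J j ∧ b (𝔼 j)) ≡ c
  xorSum-∧ : ∀ (J K f : Fin m → Bool) → xorSum {m} (λ j → (J j xor K j) ∧ f j) ≡ xorSum (λ j → J j ∧ f j) xor xorSum (λ j → K j ∧ f j)
  xorSum-∧ J K f = trans (xorSum-cong (λ j → Boolₚ.∧-distribʳ-xor (f j) (J j) (K j))) (xorSum-xor (λ j → J j ∧ f j) (λ j → K j ∧ f j))
  D+ : ∀ {u v c d} → D u c → D v d → D (u ⊞ v) (c xor d)
  D+ {u} {v} (J , p , q) (K , p′ , q′) = (λ j → J j xor K j)
    , (λ i → trans (xorSum-∧ J K (λ j → lookup (I (𝔼 j)) i))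
               (trans (cong₂ _xor_ (p i) (p′ i)) (sym (Vecₚ.lookup-zipWith _xor_ i u v))))
    , trans (xorSum-∧ J K (λ j → b (𝔼 j))) (cong₂ _xor_ q q′)
  basis : ∀ j → D (I (𝔼 j)) (b (𝔼 j))
  basis j = δ j , (λ i → xorSum-δ j (λ k → lookup (I (𝔼 k)) i)) , xorSum-δ j (λ k → b (𝔼 k))
... | inj₂ (J , p , q) = J , (λ i → trans (p i) (Vecₚ.lookup-replicate i false)) , q
... | inj₁ (a , h) = ⊥-elim (unsat (lookup a , λ j → begin
        ∣ I (𝔼 j) ∩ Vec.tabulate (lookup a) ∣ % 2 ≡⟨ cong (λ v → ∣ I (𝔼 j) ∩ v ∣ % 2) (Vecₚ.tabulate∘lookup a) ⟩
        ∣ I (𝔼 j) ∩ a ∣ % 2                       ≡⟨ odd-% ∣ I (𝔼 j) ∩ a ∣ ⟩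
        bitℕ (odd ∣ I (𝔼 j) ∩ a ∣)                ≡⟨ cong bitℕ (dot-∩ a (I (𝔼 j))) ⟨
        bitℕ (dot a (I (𝔼 j)))                    ≡⟨ cong bitℕ (Allₚ.tabulate⁻ (Allₚ.map⁻ h) j) ⟩
        bitℕ (b (𝔼 j))                            ∎))

-- Values and counts as natural numbers

ι : ℕ → ℚ
ι zero    = 0ℚ
ι (suc k) = 1ℚ +ℚ ι k

ι-+ : ∀ j k → ι (j + k) ≡ ι j +ℚ ι k
ι-+ zero    k = sym (ℚₚ.+-identityˡ (ι k))
ι-+ (suc j) k = trans (cong (1ℚ +ℚ_) (ι-+ j k)) (sym (ℚₚ.+-assoc 1ℚ (ι j) (ι k)))

∩-tabulate : ∀ {n} (v : Subset n) α → v ∩ Vec.tabulate α ≡ Vec.tabulate (λ i → lookup v i ∧ α i)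
∩-tabulate []      α = refl
∩-tabulate (x ∷ v) α = cong (x ∧ α zero ∷_) (∩-tabulate v (α ∘ suc))

value-∩ : ∀ {n} (v : Subset n) α → value (λ i → ι (bitℕ (lookup v i))) α (allFin n) ≡ ι ∣ v ∩ Vec.tabulate α ∣
value-∩ {n} v α = trans (counted id) (cong (λ u → ι ∣ u ∣) (sym (∩-tabulate v α)))
  where
  -- `allFin` is a tabulation whose tail tabulates another function, so the induction needs an
  -- arbitrary g.
  counted : ∀ {k} (g : Fin k → Fin n) → value (λ i → ι (bitℕ (lookup v i))) α (List.tabulate g)
            ≡ ι ∣ Vec.tabulate (λ i → lookup v (g i) ∧ α (g i)) ∣
  counted {zero}  g = refl
  counted {suc k} g with lookup v (g zero) | α (g zero)
  ... | true  | true  = cong (1ℚ +ℚ_) (counted (g ∘ suc))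
  ... | true  | false = trans (ℚₚ.+-identityˡ _) (counted (g ∘ suc))
  ... | false | true  = trans (ℚₚ.+-identityˡ _) (counted (g ∘ suc))
  ... | false | false = trans (ℚₚ.+-identityˡ _) (counted (g ∘ suc))

elements : ∀ {n} → Subset n → List (Fin n)
elements {n} v = filter (λ i → lookup v i Boolₚ.≟ true) (allFin n)

length-elements : ∀ {n} (v : Subset n) → length (elements v) ≡ ∣ v ∣
length-elements {n} v = trans (counted id) (cong ∣_∣ (Vecₚ.tabulate∘lookup v))
  where
  counted : ∀ {k} (g : Fin k → Fin n) →
    length (filter (λ i → lookup v i Boolₚ.≟ true) (List.tabulate g)) ≡ ∣ Vec.tabulate (lookup v ∘ g) ∣
  counted {zero}  g = refl
  counted {suc k} g with lookup v (g zero)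
  ... | true  = cong suc (counted (g ∘ suc))
  ... | false = counted (g ∘ suc)

total : ∀ {A : Set} → (A → ℕ) → List A → ℕ
total f = foldr (λ j r → f j + r) 0

odd-total : ∀ {m} (J f : Fin m → Bool) →
  odd (total (bitℕ ∘ f) (filter (λ j → J j Boolₚ.≟ true) (allFin m))) ≡ xorSum (λ j → J j ∧ f j)
odd-total {m} J f = counted id
  where
  counted : ∀ {k} (g : Fin k → Fin m) →
    odd (total (bitℕ ∘ f) (filter (λ j → J j Boolₚ.≟ true) (List.tabulate g))) ≡ xorSum (λ j → J (g j) ∧ f (g j))
  counted {zero}  g = refl
  counted {suc k} g with J (g zero)
  ... | false = counted (g ∘ suc)
  ... | true  = trans (odd-+ (bitℕ (f (g zero))) _) (cong₂ _xor_ (odd-bitℕ (f (g zero))) (counted (g ∘ suc)))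

-- Parities of linear forms

xor-cancelˡ : ∀ x {y z} → x xor y ≡ x xor z → y ≡ z
xor-cancelˡ false h = h
xor-cancelˡ true  h = Boolₚ.not-injective h

-- The constant s = −t of gap for t = τ − N: an integer t is represented by τ = t + N ∈ ℕ.
shift : ℕ → ℕ → ℚ
shift N τ = ι N +ℚ (- ι τ)

shift-+ : ∀ N τ v → shift N (v + τ) +ℚ ι v ≡ shift N τ
shift-+ N τ v = trans (cong (λ r → (ι N +ℚ (- r)) +ℚ ι v) (ι-+ v τ))
  (solve 3 (λ N τ v → (N :+ (:- (v :+ τ))) :+ v := N :+ (:- τ)) refl (ι N) (ι τ) (ι v))
  where open +-*-Solver

shift-∸ : ∀ N τ e → shift N τ +ℚ (- ι e) ≡ shift N (e + τ)
shift-∸ N τ e = trans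
  (solve 3 (λ N τ e → (N :+ (:- τ)) :+ (:- e) := N :+ (:- (e :+ τ))) refl (ι N) (ι τ) (ι e))
  (cong (λ r → ι N +ℚ (- r)) (sym (ι-+ e τ)))
  where open +-*-Solver

0≤ι : ∀ k → 0ℚ ≤ℚ ι k
0≤ι zero    = ℚₚ.≤-refl
0≤ι (suc k) = ℚₚ.+-mono-≤ (from-yes (0ℚ ℚₚ.≤? 1ℚ)) (0≤ι k)

ι-* : ∀ j k → ι (j * k) ≡ ι j *ℚ ι k
ι-* zero    k = sym (ℚₚ.*-zeroˡ (ι k))
ι-* (suc j) k = trans (ι-+ k (j * k)) (trans (cong (ι k +ℚ_) (ι-* j k))
  (solve 2 (λ j k → k :+ j :* k := (con 1ℚ :+ j) :* k) refl (ι j) (ι k)))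
  where open +-*-Solver

-- With d = N - τ, the product d(d - 2) is negative only for d = 1, which parity excludes. For d =
-- -e it is e(2 + e), and for d = 2 + e it is (2 + e)e, both products of natural numbers.
gap-constant : ∀ N τ → odd N ≡ odd τ → 0ℚ ≤ℚ shift N τ *ℚ (shift N τ +ℚ -2ℚ)
gap-constant N τ h with N ≤? τ
... | yes N≤τ = subst (0ℚ ≤ℚ_) eq (0≤ι (e * (2 + e)))
  where
  open +-*-Solver
  e = τ ∸ N
  s≡ : shift N τ ≡ - ι e
  s≡ = trans (cong (λ t → ι N +ℚ (- ι t)) (sym (ℕₚ.m+[n∸m]≡n N≤τ)))
    (trans (cong (λ r → ι N +ℚ (- r)) (ι-+ N e)) (solve 2 (λ N e → N :+ (:- (N :+ e)) := :- e) refl (ι N) (ι e)))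
  eq : ι (e * (2 + e)) ≡ shift N τ *ℚ (shift N τ +ℚ -2ℚ)
  eq = trans (ι-* e (2 + e)) (trans
    (solve 1 (λ e → e :* (con 1ℚ :+ (con 1ℚ :+ e)) := (:- e) :* ((:- e) :+ (:- (con 1ℚ :+ con 1ℚ)))) refl (ι e))
    (cong (λ s → s *ℚ (s +ℚ -2ℚ)) (sym s≡)))
... | no N≰τ with N ∸ suc τ in eqe | ℕₚ.m+[n∸m]≡n (ℕₚ.≰⇒> N≰τ)
...   | zero  | N≡ = ⊥-elim (Boolₚ.not-¬ refl (trans h (trans (sym (Boolₚ.not-involutive (odd τ)))
          (cong not (trans (cong odd (sym (ℕₚ.+-identityʳ (suc τ)))) (cong odd N≡))))))
...   | suc e | N≡ = subst (0ℚ ≤ℚ_) eq (0≤ι ((2 + e) * e))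
  where
  open +-*-Solver
  s≡ : shift N τ ≡ ι (2 + e)
  s≡ = trans (cong (λ t → ι t +ℚ (- ι τ)) (sym N≡)) (trans (cong (λ t → (1ℚ +ℚ t) +ℚ (- ι τ)) (ι-+ τ (suc e)))
    (solve 2 (λ τ e → (con 1ℚ :+ (τ :+ (con 1ℚ :+ e))) :+ (:- τ) := con 1ℚ :+ (con 1ℚ :+ e)) refl (ι τ) (ι e)))
  eq : ι ((2 + e) * e) ≡ shift N τ *ℚ (shift N τ +ℚ -2ℚ)
  eq = trans (ι-* (2 + e) e) (trans
    (solve 1 (λ e → (con 1ℚ :+ (con 1ℚ :+ e)) :* e
                 := (con 1ℚ :+ (con 1ℚ :+ e)) :* ((con 1ℚ :+ (con 1ℚ :+ e)) :+ (:- (con 1ℚ :+ con 1ℚ)))) refl (ι e))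
    (cong (λ s → s *ℚ (s +ℚ -2ℚ)) (sym s≡)))

module _ {n : ℕ} where

  gap-cong : ∀ {Λ Λ′ : Poly n} s → Λ ≋ Λ′ → gap Λ s ≋ gap Λ′ s
  gap-cong s h = ⊗-cong (++-cong h ≋-refl) (++-cong (++-cong h ≋-refl) ≋-refl)

  length-gap : ∀ (Λ : Poly n) s → length (gap Λ s) ≡ (length Λ + 1) * (length Λ + 1 + 1)
  length-gap Λ s = trans (length-⊗ (Λ ++ constP s) _) (cong₂ _*_ (Listₚ.length-++ Λ)
    (trans (Listₚ.length-++ (Λ ++ constP s)) (cong (_+ 1) (Listₚ.length-++ Λ))))

  -- Collecting terms keeps the running sum at one term per variable, however many equations have
  -- been added.
  linear-+ : ∀ (f g : Fin n → ℕ) is →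
    linear (λ i → ι (g i)) is ++ linear (λ i → ι (f i)) is ≋ linear (λ i → ι (f i + g i)) is
  linear-+ f g []       = ≋-refl
  linear-+ f g (i ∷ is) = ≋-trans
    (++-cong {P = (ι (g i) , x) ∷ []} ≋-refl (++-swap (linear (λ i → ι (g i)) is) ((ι (f i) , x) ∷ []) (linear (λ i → ι (f i)) is)))
    (++-cong {P = (ι (g i) , x) ∷ (ι (f i) , x) ∷ []} {P′ = (ι (f i + g i) , x) ∷ []} head (linear-+ f g is))
    where
    x = inj₁ i ∷ []
    head : ((ι (g i) , x) ∷ (ι (f i) , x) ∷ []) ≋ ((ι (f i + g i) , x) ∷ [])
    head = ≋-trans (++-comm ((ι (g i) , x) ∷ []) ((ι (f i) , x) ∷ []))
      (mk λ μ → coeffs (sameMono x μ))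
      where
      coeffs : ∀ t → (if t then ι (f i) else 0ℚ) +ℚ ((if t then ι (g i) else 0ℚ) +ℚ 0ℚ) ≡ (if t then ι (f i + g i) else 0ℚ) +ℚ 0ℚ
      coeffs true  = trans (sym (ℚₚ.+-assoc (ι (f i)) (ι (g i)) 0ℚ)) (cong (_+ℚ 0ℚ) (sym (ι-+ (f i) (g i))))
      coeffs false = refl

  linear-Deg : ∀ c is → Deg {n} 1 (linear c is)
  linear-Deg c is = Allₚ.map⁺ (All.universal (λ _ → s≤s z≤n) is)

  linear-0 : ∀ is → linear {n} (λ _ → 0ℚ) is ≋ []
  linear-0 []       = ≋-refl
  linear-0 (i ∷ is) = ≋-trans (∷-0 (linear (λ _ → 0ℚ) is)) (linear-0 is)

  Unique-elements : ∀ (v : Subset n) → Unique (elements v)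
  Unique-elements v = Uniqueₚ.filter⁺ _ (Uniqueₚ.allFin⁺ n)

  ∈-elements : ∀ (v : Subset n) i → lookup v i ≡ true → i ∈ elements v
  ∈-elements v i h = ∈-filter⁺ (λ i → lookup v i Boolₚ.≟ true) (∈-allFin i) h

  ineqPoly-Deg : ∀ (v T : Subset n) → Deg 1 (ineqPoly v T) × length (ineqPoly v T) ≤ length (allFin n) + 1
  ineqPoly-Deg v T = go (allFin n)
    where
    go : ∀ is → Deg 1 (ineqSum v T is) × length (ineqSum v T is) ≤ length is + 1
    go []       = z≤n ∷ [] , s≤s z≤n
    go (i ∷ is) with lookup v i | lookup T i | go is
    ... | false | _     | h , l = h , ℕₚ.m≤n⇒m≤1+n l
    ... | true  | true  | h , l = s≤s z≤n ∷ h , s≤s l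
    ... | true  | false | h , l = s≤s z≤n ∷ h , s≤s l

-- Stages of the refutation

gapBound stageLength lineBound : ℕ → ℕ
-- The first summand counts the terms of a gap of two forms with n terms each, the second those of
-- the cofactor in `gap-shift`. In `stageLength`, which bounds the tree of a single line, n · 14 + 8
-- is the cost of `falsified` and covers that of `linear-value`.
gapBound n    = (n + n + 1) * (n + n + 1 + 1) + (2 + (n + n + (2 + n)))
stageLength n = stepCost (gapBound n) (n * 14 + 8) + 3
lineBound n   = stageLength n * (3 + (gapBound n + (n + 1)))

length-allFin : ∀ n → length (allFin n) ≡ n
length-allFin n = Listₚ.length-tabulate id

-- Here g bounds the terms of a gap, k the tree of one new line, w the terms of a leaf and W the
-- terms of any line; `hiMax` bounds every τ that occurs.
module Stages {n m : ℕ} (𝔼 : Instance n m) (y₀ : Var n) (1≤n : 1 ≤ n) (N hiMax : ℕ)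
  (g k w W : ℕ) (gapBound≤g : gapBound n ≤ g) (g≤w : g ≤ w) (n+1≤w : n + 1 ≤ w) (3≤w : 3 ≤ w)
  (stepCost≤k : stepCost g (n * 14 + 8) ≤ k) (3≤k : 3 ≤ k) (w≤W : w ≤ W) (kw≤W : k * w ≤ W) where

  H : Poly n → Set
  H = S 𝔼

  stage : ℕ
  stage = suc hiMax * suc k

  gap-short : ∀ (Λ : Poly n) s → length Λ ≤ n + n → length (gap Λ s) ≤ g
  gap-short Λ s h = ℕₚ.≤-trans (ℕₚ.≤-reflexive (length-gap Λ s))
    (ℕₚ.≤-trans (ℕₚ.*-mono-≤ (ℕₚ.+-monoˡ-≤ 1 h) (ℕₚ.+-monoˡ-≤ 1 (ℕₚ.+-monoˡ-≤ 1 h)))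
    (ℕₚ.≤-trans (ℕₚ.m≤m+n _ (2 + (n + n + (2 + n)))) gapBound≤g))

  -- As N is even, τ and t = τ − N have the same parity: these lines encode Λ ≡ β (mod 2).
  Window : Poly n → Bool → ℕ → ℕ → List (Poly n) → Set
  Window Λ β lo hi π = ∀ {τ} → lo ≤ τ → τ ≤ hi → odd τ ≡ β → gap Λ (shift N τ) ∈ π

  -- Every line of the new window is derived from the old list π alone, and there are at most
  -- `suc hiMax` of them, so all stages obey the same length bound.
  extend : ∀ {K π} Λ β lo hi → length Λ ≤ n → Deg 1 Λ → hi ≤ hiMax → Proof H 6 W K π →
    (∀ {τ} → lo ≤ τ → τ ≤ hi → odd τ ≡ β → Derives H w (_∈ π) 6 k (gap Λ (shift N τ))) →
    Σ (List (Poly n)) λ π′ → Proof H 6 W (stage + K) π′ × Window Λ β lo hi π′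
  extend {K} {π} Λ β lo hi l d hi≤ p f
    with appendAll H w {A = _∈ π} (Allₚ.map⁺ (All.map line (Allₚ.all-filter inWindow? (upTo (suc hi))))) kw≤W id p
    where
    inWindow? = λ τ → (lo ≤? τ) ×-dec ((τ ≤? hi) ×-dec (odd τ Boolₚ.≟ β))
    line : ∀ {τ} → (lo ≤ τ) × ((τ ≤ hi) × (odd τ ≡ β)) →
      Derives H w (_∈ π) 6 k (gap Λ (shift N τ)) × Deg 6 (gap Λ (shift N τ)) × length (gap Λ (shift N τ)) ≤ W
    line {τ} (a , b , c) = f a b c , Deg-mono (s≤s (s≤s z≤n)) (gap-Deg Λ (shift N τ) d)
      , ℕₚ.≤-trans (gap-short Λ (shift N τ) (ℕₚ.≤-trans l (ℕₚ.m≤m+n n n))) (ℕₚ.≤-trans g≤w w≤W)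
  ... | π′ , p′ , _ , Ps⊆ = π′
    , record { valid = Proof.valid p′ ; lines = Proof.lines p′
             ; short = ℕₚ.≤-trans (Proof.short p′) (ℕₚ.+-monoˡ-≤ K (ℕₚ.*-monoˡ-≤ (suc k) count)) }
    , λ a b c → Ps⊆ (∈-map⁺ _ (∈-filter⁺ inWindow? (∈-upTo⁺ (s≤s b)) (a , b , c)))
    where
    inWindow? = λ τ → (lo ≤? τ) ×-dec ((τ ≤? hi) ×-dec (odd τ Boolₚ.≟ β))
    count : length (map (λ τ → gap Λ (shift N τ)) (filter inWindow? (upTo (suc hi)))) ≤ suc hiMax
    count = ℕₚ.≤-trans (ℕₚ.≤-reflexive (Listₚ.length-map _ (filter inWindow? (upTo (suc hi)))))
      (ℕₚ.≤-trans (Listₚ.length-filter inWindow? (upTo (suc hi)))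
      (ℕₚ.≤-trans (ℕₚ.≤-reflexive (Listₚ.length-upTo (suc hi))) (s≤s hi≤)))

  premise : ∀ {π Λ s s′} → length Λ ≤ n → Deg 1 Λ → gap Λ s ∈ π → s ≡ s′ → Derives H w (_∈ π) 2 1 (gap Λ s′)
  premise {Λ = Λ} {s} l d m refl = derives
    (given m (gap-Deg Λ s d) (ℕₚ.≤-trans (gap-short Λ s (ℕₚ.≤-trans l (ℕₚ.m≤m+n n n))) g≤w)) ≋-refl ℕₚ.≤-refl

  step′ : ∀ {π} Λ ℓ s is → length Λ ≤ n → length ℓ ≤ n → Deg 1 Λ → Deg 1 ℓ → Unique is → length is ≤ 3 →
    (∀ α → _⊩₀[_]_ H 3≤w {_∈ π} 4 (n * 14 + 8) (mono (lits α is)) ⊎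
       Σ ℚ λ v → _⊩₀[_]_ H 3≤w {_∈ π} 4 (n * 14 + 8) (mono (lits α is) ⊗ (ℓ ++ constP (- v)))
               × Derives H w (_∈ π) 2 1 (gap Λ (s +ℚ v))) →
    Derives H w (_∈ π) 6 k (gap (Λ ++ ℓ) s)
  step′ Λ ℓ s is Λ≤ ℓ≤ d e u h f = ⊢-mono H w ℕₚ.≤-refl stepCost≤k (step H 3≤w y₀ Λ ℓ s is d e u h
    (gap-short (Λ ++ ℓ) s (ℕₚ.≤-trans (ℕₚ.≤-reflexive (Listₚ.length-++ Λ)) (ℕₚ.+-mono-≤ Λ≤ ℓ≤)))
    (ℕₚ.≤-trans (s≤s (s≤s (ℕₚ.+-mono-≤ (ℕₚ.+-mono-≤ Λ≤ Λ≤) (s≤s (s≤s ℓ≤)))))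
      (ℕₚ.≤-trans (ℕₚ.m≤n+m _ ((n + n + 1) * (n + n + 1 + 1))) gapBound≤g)) f)

  length-linear : ∀ c → length (linear {n} c (allFin n)) ≤ n
  length-linear c = ℕₚ.≤-reflexive (trans (Listₚ.length-map _ (allFin n)) (length-allFin n))

  multiplicity : List (Fin m) → Fin n → ℕ
  multiplicity js i = total (λ j → bitℕ (lookup (I (𝔼 j)) i)) js

  rhs : List (Fin m) → ℕ
  rhs = total (λ j → bitℕ (b (𝔼 j)))

  -- The sum of the left-hand sides over the integers. Cancellation modulo 2 shows up only as even
  -- coefficients, which `dropVariable` removes at the end.
  sumForm : List (Fin m) → Poly n
  sumForm js = linear (λ i → ι (multiplicity js i)) (allFin n)

  start : ∀ lo hi → hi ≤ hiMax → odd N ≡ false →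
    Σ (List (Poly n)) λ π → Proof H 6 W (stage + 0) π × Window (sumForm []) false lo hi π
  start lo hi hi≤ N-even = extend (sumForm []) false lo hi (length-linear _) (linear-Deg _ (allFin n)) hi≤
      (record { valid = [] ; lines = [] ; short = z≤n })
      (λ {τ} _ _ τ-even → ⊢-≋ H w (≋-sym (eq τ)) (constant _ (gap-constant N τ (trans N-even (sym τ-even)))))
    where
    constant : ∀ c → 0ℚ ≤ℚ c → Derives H w (_∈ []) 6 k (constP c)
    constant c 0≤c with ℚₚ.<-cmp 0ℚ c
    ... | tri< 0<c _ _ = ⊢-≋ H w (≡⇒≋ (cong constP (ℚₚ.*-identityʳ c)))
          (⊢-mono H w (z≤n {6}) (ℕₚ.≤-trans (ℕₚ.n≤1+n 2) 3≤k) (⊢-times H w c 0<c (one₊ H 3≤w)))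
    -- The constant 0 occurs, for t = 0 and t = -2, and is no positive multiple of 1.
    ... | tri≈ _ refl _ = ⊢-≋ H w (≋-sym (∷-0 [])) (⊢-mono H w ℕₚ.≤-refl 3≤k
          (proj₁ (⊢₀-zero H w y₀ (ℕₚ.≤-trans (ℕₚ.n≤1+n 2) 3≤w) (s≤s (s≤s z≤n)))))
    ... | tri> _ _ c<0 = ⊥-elim (ℚₚ.<-irrefl refl (ℚₚ.<-≤-trans c<0 0≤c))
    eq : ∀ τ → gap (sumForm []) (shift N τ) ≋ constP (shift N τ *ℚ (shift N τ +ℚ -2ℚ))
    eq τ = ≋-trans (gap-cong (shift N τ) (linear-0 (allFin n)))
      (⊗-congˡ (constP (shift N τ)) (≋-sym (constP-+ (shift N τ) -2ℚ)))

  -- If α satisfies the equation and makes c of its variables true, the line for τ comes from the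
  -- old line for τ - c, whose parity is right because c ≡ b. As c is at most 3, raising the lower
  -- end by 4 is enough; a multiple of 4 keeps the total loss even, which suits the parity of N.
  addEquation : ∀ {K π} j js lo hi → hi ≤ hiMax → Proof H 6 W K π →
    Window (sumForm js) (odd (rhs js)) lo hi π →
    Σ (List (Poly n)) λ π′ → Proof H 6 W (stage + K) π′ × Window (sumForm (j ∷ js)) (odd (rhs (j ∷ js))) (4 + lo) hi π′
  addEquation {K} {π} j js lo hi hi≤ p win =
      extend (sumForm (j ∷ js)) (odd (rhs (j ∷ js))) (4 + lo) hi (length-linear _) (linear-Deg _ (allFin n)) hi≤ p
        (λ {τ} a b c → ⊢-≋ H w (gap-cong (shift N τ) (linear-+ (λ i → bitℕ (lookup v i)) (multiplicity js) (allFin n)))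
          (step′ (sumForm js) (linear coef (allFin n)) (shift N τ) (elements v) (length-linear _) (length-linear _)
            (linear-Deg _ (allFin n)) (linear-Deg _ (allFin n)) (Unique-elements v) short-elements (branch τ a b c)))
    where
    v = I (𝔼 j)
    coef : Fin n → ℚ
    coef i = ι (bitℕ (lookup v i))
    short-elements : length (elements v) ≤ 3
    short-elements = ℕₚ.≤-trans (ℕₚ.≤-reflexive (length-elements v)) (small (𝔼 j))
    supp : ∀ i → coef i ≡ 0ℚ ⊎ i ∈ elements v
    supp i with lookup v i in e
    ... | true  = inj₂ (∈-elements v i e)
    ... | false = inj₁ refl
    len : length (allFin n) * 14 + 8 ≡ n * 14 + 8
    len = cong (λ l → l * 14 + 8) (length-allFin n)
    branch : ∀ τ → 4 + lo ≤ τ → τ ≤ hi → odd τ ≡ odd (rhs (j ∷ js)) → ∀ α →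
       _⊩₀[_]_ H 3≤w {_∈ π} 4 (n * 14 + 8) (mono (lits α (elements v))) ⊎
       Σ ℚ λ r → _⊩₀[_]_ H 3≤w {_∈ π} 4 (n * 14 + 8) (mono (lits α (elements v)) ⊗ (linear coef (allFin n) ++ constP (- r)))
               × Derives H w (_∈ π) 2 1 (gap (sumForm js) (shift N τ +ℚ r))
    branch τ lo≤τ τ≤hi τ-odd α with odd ∣ v ∩ Vec.tabulate α ∣ Boolₚ.≟ b (𝔼 j)
    ... | yes sat = inj₂ (ι c
          , subst (λ r → _⊩₀[_]_ H 3≤w {_∈ π} 4 (n * 14 + 8) (mono (lits α (elements v)) ⊗ (linear coef (allFin n) ++ constP (- r))))
              (value-∩ v α)
              (⊢₀-mono H w ℕₚ.≤-refl (ℕₚ.≤-trans (ℕₚ.+-monoʳ-≤ (length (allFin n) * 14) (ℕₚ.m≤m+n 3 5)) (ℕₚ.≤-reflexive len))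
                (linear-value H 3≤w y₀ α (elements v) short-elements coef (allFin n) (All.universal supp (allFin n))))
          , premise {Λ = sumForm js} (length-linear _) (linear-Deg _ (allFin n))
              (win lo≤τ′ (ℕₚ.≤-trans (ℕₚ.m∸n≤m τ c) τ≤hi) τ′-odd)
              (trans (sym (shift-+ N τ′ c)) (cong (λ t → shift N t +ℚ ι c) τ≡)))
      where
      c = ∣ v ∩ Vec.tabulate α ∣
      c≤4 : c ≤ 4
      c≤4 = ℕₚ.≤-trans (∣p∩q∣≤∣p∣ v (Vec.tabulate α)) (ℕₚ.m≤n⇒m≤1+n (small (𝔼 j)))
      τ′ = τ ∸ c
      τ≡ : c + τ′ ≡ τ
      τ≡ = ℕₚ.m+[n∸m]≡n (ℕₚ.≤-trans c≤4 (ℕₚ.≤-trans (ℕₚ.m≤m+n 4 lo) lo≤τ))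
      lo≤τ′ : lo ≤ τ′
      lo≤τ′ = ℕₚ.+-cancelˡ-≤ c lo τ′ (ℕₚ.≤-trans (ℕₚ.+-monoˡ-≤ lo c≤4) (ℕₚ.≤-trans lo≤τ (ℕₚ.≤-reflexive (sym τ≡))))
      τ′-odd : odd τ′ ≡ odd (rhs js)
      τ′-odd = xor-cancelˡ (b (𝔼 j)) (begin
        b (𝔼 j) xor odd τ′        ≡⟨ cong (_xor odd τ′) sat ⟨
        odd c xor odd τ′          ≡⟨ odd-+ c τ′ ⟨
        odd (c + τ′)              ≡⟨ cong odd τ≡ ⟩
        odd τ                     ≡⟨ τ-odd ⟩
        odd (bitℕ (b (𝔼 j)) + rhs js) ≡⟨ odd-+ (bitℕ (b (𝔼 j))) (rhs js) ⟩
        odd (bitℕ (b (𝔼 j))) xor odd (rhs js) ≡⟨ cong (_xor odd (rhs js)) (odd-bitℕ (b (𝔼 j))) ⟩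
        b (𝔼 j) xor odd (rhs js)  ∎)
    ... | no unsat = inj₁ (subst (λ l → _⊩₀[_]_ H 3≤w {_∈ π} 4 l (mono (lits α (elements v)))) len
            (falsified H 3≤w y₀ α (elements v) short-elements v T (∈-elements v)
              (λ i h → trans (Vecₚ.lookup-zipWith _∧_ i v (Vec.tabulate α)) (cong₂ _∧_ h (Vecₚ.lookup∘tabulate α i)))
              (derives (base (inj₁ (j , T , p∩q⊆p v (Vec.tabulate α) , T-odd , λ _ → refl)) (proj₁ (ineqPoly-Deg v T))
                  (ℕₚ.≤-trans (proj₂ (ineqPoly-Deg v T)) (ℕₚ.≤-trans (ℕₚ.≤-reflexive (cong (_+ 1) (length-allFin n))) n+1≤w)))
                ≋-refl ℕₚ.≤-refl)))
      where
      -- The variables of the equation that α makes true. As α violates the equation, |T| + b is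
      -- odd, so T indexes a hypothesis, and precisely the one that α falsifies.
      T = v ∩ Vec.tabulate α
      T-odd : (∣ T ∣ + bitℕ (b (𝔼 j))) % 2 ≡ 1
      T-odd = trans (odd-% (∣ T ∣ + bitℕ (b (𝔼 j)))) (cong bitℕ (begin
        odd (∣ T ∣ + bitℕ (b (𝔼 j)))          ≡⟨ odd-+ ∣ T ∣ (bitℕ (b (𝔼 j))) ⟩
        odd ∣ T ∣ xor odd (bitℕ (b (𝔼 j)))    ≡⟨ cong₂ _xor_ (Boolₚ.¬-not unsat) (odd-bitℕ (b (𝔼 j))) ⟩
        not (b (𝔼 j)) xor b (𝔼 j)             ≡⟨ Boolₚ.xor-inverseˡ (b (𝔼 j)) ⟩
        true                                  ∎))

  addEquations : ∀ js hi → hi ≤ hiMax → odd N ≡ false →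
    Σ (List (Poly n)) λ π → Proof H 6 W (suc (length js) * stage) π × Window (sumForm js) (odd (rhs js)) (length js * 4) hi π
  addEquations []       hi hi≤ e = start 0 hi hi≤ e
  addEquations (j ∷ js) hi hi≤ e with addEquations js hi hi≤ e
  ... | π , p , win = addEquation j js (length js * 4) hi hi≤ p win

  -- Adding -a X, where a is the coefficient of X, cancels the term. Its value is 0 or -a, so the
  -- line for τ comes from that for τ or τ + a; both have the same parity since a is even. The upper
  -- end falls by a, and neither branch is contradictory.
  dropVariable : ∀ {K π} (a : Fin n → ℕ) i is β lo hi → odd (a i) ≡ false →
    suc (length is) ≤ n → hi ≤ hiMax → Proof H 6 W K π →
    Window (linear (λ i → ι (a i)) (i ∷ is)) β lo (a i + hi) π →
    Σ (List (Poly n)) λ π′ → Proof H 6 W (stage + K) π′ × Window (linear (λ i → ι (a i)) is) β lo hi π′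
  dropVariable {K} {π} a i is β lo hi ai-even l hi≤ p win =
      extend Λ′ β lo hi (ℕₚ.≤-trans (ℕₚ.≤-reflexive (Listₚ.length-map _ is)) (ℕₚ.≤-trans (ℕₚ.n≤1+n _) l))
        (linear-Deg _ is) hi≤ p
        (λ {τ} x y z → ⊢-≋ H w (gap-cong (shift N τ) cancel)
          (step′ Λ (linear coef (i ∷ [])) (shift N τ) (i ∷ [])
            lenΛ 1≤n (linear-Deg _ (i ∷ is)) (linear-Deg coef (i ∷ [])) ([] ∷ []) (s≤s z≤n) (branch x y z)))
    where
    Λ′ = linear (λ i → ι (a i)) is
    Λ = linear (λ i → ι (a i)) (i ∷ is)
    lenΛ : length Λ ≤ n
    lenΛ = ℕₚ.≤-trans (ℕₚ.≤-reflexive (Listₚ.length-map _ (i ∷ is))) l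
    coef : Fin n → ℚ
    coef j = - ι (a i)
    cancel : Λ ++ linear coef (i ∷ []) ≋ Λ′
    cancel = ≋-trans (≋-trans (++-comm Λ (linear coef (i ∷ []))) (++-cong
      {P = (- ι (a i) , inj₁ i ∷ []) ∷ (ι (a i) , inj₁ i ∷ []) ∷ []} {P′ = []}
      (mk λ μ → coeffs (sameMono (inj₁ i ∷ []) μ)) ≋-refl)) ≋-refl
      where
      coeffs : ∀ t → (if t then - ι (a i) else 0ℚ) +ℚ ((if t then ι (a i) else 0ℚ) +ℚ 0ℚ) ≡ 0ℚ
      coeffs true  = trans (sym (ℚₚ.+-assoc (- ι (a i)) (ι (a i)) 0ℚ)) (trans (ℚₚ.+-identityʳ (- ι (a i) +ℚ ι (a i))) (ℚₚ.+-inverseˡ (ι (a i))))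
      coeffs false = refl
    branch : ∀ {τ} → lo ≤ τ → τ ≤ hi → odd τ ≡ β → ∀ α →
       _⊩₀[_]_ H 3≤w {_∈ π} 4 (n * 14 + 8) (mono (lits α (i ∷ []))) ⊎
       Σ ℚ λ r → _⊩₀[_]_ H 3≤w {_∈ π} 4 (n * 14 + 8) (mono (lits α (i ∷ [])) ⊗ (linear coef (i ∷ []) ++ constP (- r)))
               × Derives H w (_∈ π) 2 1 (gap Λ (shift N τ +ℚ r))
    branch {τ} lo≤τ τ≤hi τ-odd α = inj₂ (value coef α (i ∷ [])
      , ⊢₀-mono H w ℕₚ.≤-refl (ℕₚ.≤-trans (ℕₚ.+-mono-≤ (ℕₚ.*-monoˡ-≤ 14 1≤n) (ℕₚ.m≤m+n 3 5)) ℕₚ.≤-refl)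
          (linear-value H 3≤w y₀ α (i ∷ []) (s≤s z≤n) coef (i ∷ []) (inj₂ (here refl) ∷ []))
      , premiseFor (α i))
      where
      premiseFor : ∀ t → Derives H w (_∈ π) 2 1 (gap Λ (shift N τ +ℚ ((- ι (a i)) *ℚ bitℚ t +ℚ 0ℚ)))
      premiseFor true = premise {Λ = Λ} lenΛ (linear-Deg _ (i ∷ is))
        (win (ℕₚ.≤-trans lo≤τ (ℕₚ.m≤n+m τ (a i))) (ℕₚ.+-monoʳ-≤ (a i) τ≤hi)
             (trans (odd-+ (a i) τ) (trans (cong (_xor odd τ) ai-even) τ-odd)))
        (trans (sym (shift-∸ N τ (a i))) (cong (shift N τ +ℚ_) (sym (trans (ℚₚ.+-identityʳ (- ι (a i) *ℚ 1ℚ)) (ℚₚ.*-identityʳ (- ι (a i)))))))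
      premiseFor false = premise {Λ = Λ} lenΛ (linear-Deg _ (i ∷ is))
        (win lo≤τ (ℕₚ.≤-trans τ≤hi (ℕₚ.m≤n+m hi (a i))) τ-odd)
        (sym (trans (cong (shift N τ +ℚ_) (trans (ℚₚ.+-identityʳ (- ι (a i) *ℚ 0ℚ)) (ℚₚ.*-zeroʳ (- ι (a i))))) (ℚₚ.+-identityʳ (shift N τ))))

  dropVariables : ∀ {K π} (a : Fin n → ℕ) is β lo hi → (∀ i → odd (a i) ≡ false) → length is ≤ n → total a is + hi ≤ hiMax →
    Proof H 6 W K π → Window (linear (λ i → ι (a i)) is) β lo (total a is + hi) π →
    Σ (List (Poly n)) λ π′ → Proof H 6 W (length is * stage + K) π′ × Window [] β lo hi π′
  dropVariables {π = π} a [] β lo hi even l hi≤ p win = π , p , win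
  dropVariables {K} {π} a (i ∷ is) β lo hi even l hi≤ p win =
      finish (dropVariable a i is β lo (total a is + hi) (even i) l
        (ℕₚ.≤-trans (ℕₚ.m≤n+m (total a is + hi) (a i)) (ℕₚ.≤-trans (ℕₚ.≤-reflexive assoc) hi≤)) p
        (λ {τ} x y → win {τ} x (ℕₚ.≤-trans y (ℕₚ.≤-reflexive assoc))))
    where
    assoc : a i + (total a is + hi) ≡ a i + total a is + hi
    assoc = sym (ℕₚ.+-assoc (a i) (total a is) hi)
    Result : ℕ → Set
    Result k′ = Σ (List (Poly n)) λ π′ → Proof H 6 W k′ π′ × Window [] β lo hi π′
    lines-≡ : length is * stage + (stage + K) ≡ suc (length is) * stage + K
    lines-≡ = trans (sym (ℕₚ.+-assoc (length is * stage) stage K)) (cong (_+ K) (ℕₚ.+-comm (length is * stage) stage))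
    finish : (Σ (List (Poly n)) λ π′ → Proof H 6 W (stage + K) π′ × Window (linear (λ i → ι (a i)) is) β lo (total a is + hi) π′) →
      Result (suc (length is) * stage + K)
    finish (π₁ , p₁ , win₁) = subst Result lines-≡
      (dropVariables a is β lo hi even (ℕₚ.≤-trans (ℕₚ.n≤1+n (length is)) l)
        (ℕₚ.≤-trans (ℕₚ.+-monoˡ-≤ hi (ℕₚ.m≤n+m (total a is) (a i))) hi≤) p₁ win₁)

  -- Only the line τ = t, that is the integer -1, has to survive. Additions raise the lower end to
  -- at most t, and the upper end starts higher by the sum of all coefficients, so that the removals
  -- bring it down to exactly t.
  refute : ∀ js t → N ≡ suc t → odd t ≡ true → (∀ i → odd (multiplicity js i) ≡ false) → odd (rhs js) ≡ true →
    total (multiplicity js) (allFin n) + t ≤ hiMax → length js * 4 ≤ t →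
    Σ (List (Poly n)) λ π → Refutation H π × All (λ P → Deg 6 P × length P ≤ W) π × length π ≤ suc ((n + suc (length js)) * stage)
  refute js t refl t-odd even-rows odd-rhs fits lo≤t = finish (dropVariables (multiplicity js) (allFin n) (odd (rhs js)) (length js * 4) t
      even-rows (ℕₚ.≤-reflexive (length-allFin n)) fits (proj₁ (proj₂ added)) (proj₂ (proj₂ added)))
    where
    added = addEquations js (total (multiplicity js) (allFin n) + t) fits (cong not t-odd)
    shift≡1 : shift (suc t) t ≡ 1ℚ
    shift≡1 = solve 1 (λ x → (con 1ℚ :+ x) :+ (:- x) := con 1ℚ) refl (ι t)
      where open +-*-Solver
    last : constP (- 1ℚ) ≋ scale 1ℚ (gap [] (shift (suc t) t))
    last = ≋-sym (≋-trans (scale-1 (gap [] (shift (suc t) t))) (≋-trans (≡⇒≋ (cong (gap []) shift≡1)) (≋-sym (constP-+ 1ℚ -2ℚ))))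
    finish : (Σ (List (Poly n)) λ π → Proof H 6 W (length (allFin n) * stage + suc (length js) * stage) π
                                    × Window [] (odd (rhs js)) (length js * 4) t π) → _
    finish (π , p , win) = constP (- 1ℚ) ∷ π
      , (pos 1ℚ (gap [] (shift (suc t) t)) (0<1 H w) (win lo≤t ℕₚ.≤-refl (trans t-odd (sym odd-rhs))) (at last) ∷ Proof.valid p , λ _ → refl)
      , (z≤n ∷ [] , ℕₚ.≤-trans (ℕₚ.≤-trans (s≤s z≤n) 3≤w) w≤W) ∷ Proof.lines p
      , s≤s (ℕₚ.≤-trans (Proof.short p) (ℕₚ.≤-reflexive (trans
          (sym (ℕₚ.*-distribʳ-+ stage (length (allFin n)) (suc (length js))))
          (cong (λ l → (l + suc (length js)) * stage) (length-allFin n)))))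

-- Choice of the window and the resulting size

total-≤ : ∀ {A : Set} (f : A → ℕ) M → (∀ x → f x ≤ M) → ∀ xs → total f xs ≤ length xs * M
total-≤ f M h []       = z≤n
total-≤ f M h (x ∷ xs) = ℕₚ.+-mono-≤ (h x) (total-≤ f M h xs)

even-*4 : ∀ k → odd (k * 4) ≡ false
even-*4 zero    = refl
even-*4 (suc k) = trans (Boolₚ.not-involutive _) (trans (Boolₚ.not-involutive _) (even-*4 k))

-- A term of degree at most 6 has 7 symbols, its coefficient included; the successor is the symbol
-- charged for the line itself.
proofSize-≤ : ∀ {n W} (π : List (Poly n)) → All (λ P → Deg 6 P × length P ≤ W) π → proofSize π ≤ length π * suc (W * 7)
proofSize-≤ []      []             = z≤n
proofSize-≤ (P ∷ π) ((d , l) ∷ ls) =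
  ℕₚ.+-mono-≤ (s≤s (ℕₚ.≤-trans (polySize-≤ P d) (ℕₚ.*-monoˡ-≤ 7 l))) (proofSize-≤ π ls)
  where
  polySize-≤ : ∀ P → Deg 6 P → polySize P ≤ length P * 7
  polySize-≤ []      []       = z≤n
  polySize-≤ (t ∷ P) (d ∷ ds) = ℕₚ.+-mono-≤ (s≤s d) (polySize-≤ P ds)

≤-*ˡ : ∀ {k} w → 3 ≤ k → w ≤ k * w
≤-*ˡ w (s≤s _) = ℕₚ.m≤m+n w _

sizeBound : ℕ → ℕ → ℕ
sizeBound n m = suc ((n + suc m) * (suc (n * m + suc (m * 4)) * suc (stageLength n))) * suc (lineBound n * 7)

refutation : ∀ {n m} (𝔼 : Instance (suc n) m) → Unsatisfiable 𝔼 → Σ (List (Poly (suc n))) λ π →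
  Refutation (S 𝔼) π × DegreeAtMost 6 π × proofSize π ≤ sizeBound (suc n) m
refutation {n′} {m} 𝔼 unsat = conclude
  (refute js (suc (m * 4)) refl (cong not (even-*4 m))
    (λ i → trans (odd-total J (λ j → lookup (I (𝔼 j)) i)) (proj₁ (proj₂ combination) i))
    (trans (odd-total J (λ j → b (𝔼 j))) (proj₂ (proj₂ combination)))
    fits (ℕₚ.≤-trans (ℕₚ.*-monoˡ-≤ 4 js≤m) (ℕₚ.n≤1+n (m * 4))))
  where
  n : ℕ
  n = suc n′
  combination = contradictory-sum 𝔼 unsat
  J = proj₁ combination
  -- The offset N = 4m + 2 is even and leaves t = 4m + 1 above the loss from m additions. Removals
  -- cost at most n · m, since each of the n coefficients is at most m.
  open Stages 𝔼 (inj₁ zero) (s≤s z≤n) (suc (suc (m * 4))) (n * m + suc (m * 4))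
    (gapBound n) (stageLength n) (3 + (gapBound n + (n + 1))) (lineBound n)
    ℕₚ.≤-refl (ℕₚ.≤-trans (ℕₚ.m≤m+n (gapBound n) (n + 1)) (ℕₚ.m≤n+m (gapBound n + (n + 1)) 3))
    (ℕₚ.≤-trans (ℕₚ.m≤n+m (n + 1) (gapBound n)) (ℕₚ.m≤n+m (gapBound n + (n + 1)) 3))
    (ℕₚ.m≤m+n 3 (gapBound n + (n + 1)))
    (ℕₚ.m≤m+n (stepCost (gapBound n) (n * 14 + 8)) 3) (ℕₚ.m≤n+m 3 (stepCost (gapBound n) (n * 14 + 8)))
    (≤-*ˡ (3 + (gapBound n + (n + 1))) (ℕₚ.m≤n+m 3 (stepCost (gapBound n) (n * 14 + 8)))) ℕₚ.≤-refl

  js : List (Fin m)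
  js = filter (λ j → J j Boolₚ.≟ true) (allFin m)

  js≤m : length js ≤ m
  js≤m = ℕₚ.≤-trans (Listₚ.length-filter (λ j → J j Boolₚ.≟ true) (allFin m)) (ℕₚ.≤-reflexive (length-allFin m))

  multiplicity≤m : ∀ i → multiplicity js i ≤ m
  multiplicity≤m i = ℕₚ.≤-trans (total-≤ (λ j → bitℕ (lookup (I (𝔼 j)) i)) 1 (λ j → bit≤1 (lookup (I (𝔼 j)) i)) js)
    (ℕₚ.≤-trans (ℕₚ.≤-reflexive (ℕₚ.*-identityʳ (length js))) js≤m)
    where
    bit≤1 : ∀ x → bitℕ x ≤ 1
    bit≤1 true  = s≤s z≤n
    bit≤1 false = z≤n

  fits : total (multiplicity js) (allFin n) + suc (m * 4) ≤ n * m + suc (m * 4)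
  fits = ℕₚ.+-monoˡ-≤ (suc (m * 4)) (ℕₚ.≤-trans (total-≤ (multiplicity js) m multiplicity≤m (allFin n))
    (ℕₚ.≤-reflexive (cong (_* m) (length-allFin n))))

  conclude : (Σ (List (Poly n)) λ π → Refutation H π × All (λ P → Deg 6 P × length P ≤ lineBound n) π
               × length π ≤ suc ((n + suc (length js)) * stage)) →
    Σ (List (Poly n)) λ π → Refutation (S 𝔼) π × DegreeAtMost 6 π × proofSize π ≤ sizeBound n m
  conclude (π , r , ls , short) = π , r , All.map proj₁ ls
    , ℕₚ.≤-trans (proofSize-≤ π ls) (ℕₚ.*-monoˡ-≤ (suc (lineBound n * 7))
        (ℕₚ.≤-trans short (s≤s (ℕₚ.*-monoˡ-≤ stage (ℕₚ.+-monoʳ-≤ n (s≤s js≤m))))))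

-- Polynomial size

-- One power of 1 + n + m suffices as a normal form for bounds: the base is at least 1, so a bound
-- survives raising its exponent, and sums and products stay in this form.
record Polynomial (F : ℕ → ℕ → ℕ) : Set where
  constructor polynomial
  field
    multiplier degree : ℕ
    bound          : ∀ n m → F n m ≤ multiplier * suc (n + m) ^ degree

private variable F G : ℕ → ℕ → ℕ

^-mono : ∀ N {d e} → d ≤ e → suc N ^ d ≤ suc N ^ e
^-mono N = ℕₚ.^-monoʳ-≤ (suc N)

con : ∀ k → Polynomial (λ _ _ → k)
con k = polynomial k 0 (λ _ _ → ℕₚ.≤-reflexive (sym (ℕₚ.*-identityʳ k)))

var₁ : Polynomial (λ n _ → n)
var₁ = polynomial 1 1 λ n m → ℕₚ.≤-trans (ℕₚ.m≤n⇒m≤1+n (ℕₚ.m≤m+n n m))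
  (ℕₚ.≤-reflexive (sym (trans (ℕₚ.*-identityˡ (suc (n + m) ^ 1)) (ℕₚ.*-identityʳ (suc (n + m))))))

var₂ : Polynomial (λ _ m → m)
var₂ = polynomial 1 1 λ n m → ℕₚ.≤-trans (ℕₚ.m≤n⇒m≤1+n (ℕₚ.m≤n+m m n))
  (ℕₚ.≤-reflexive (sym (trans (ℕₚ.*-identityˡ (suc (n + m) ^ 1)) (ℕₚ.*-identityʳ (suc (n + m))))))

infixl 6 _⊹_
infixl 7 _⊛_

_⊹_ : Polynomial F → Polynomial G → Polynomial (λ n m → F n m + G n m)
polynomial a d f ⊹ polynomial c e g = polynomial (a + c) (d + e) λ n m →
  ℕₚ.≤-trans (ℕₚ.+-mono-≤ (f n m) (g n m))
  (ℕₚ.≤-trans (ℕₚ.+-mono-≤ (ℕₚ.*-monoʳ-≤ a (^-mono (n + m) (ℕₚ.m≤m+n d e)))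
                           (ℕₚ.*-monoʳ-≤ c (^-mono (n + m) (ℕₚ.m≤n+m e d))))
  (ℕₚ.≤-reflexive (sym (ℕₚ.*-distribʳ-+ (suc (n + m) ^ (d + e)) a c))))

_⊛_ : Polynomial F → Polynomial G → Polynomial (λ n m → F n m * G n m)
polynomial a d f ⊛ polynomial c e g = polynomial (a * c) (d + e) λ n m →
  ℕₚ.≤-trans (ℕₚ.*-mono-≤ (f n m) (g n m)) (ℕₚ.≤-reflexive (trans
    (ℕₚ.[m*n]*[o*p]≡[m*o]*[n*p] a (suc (n + m) ^ d) c (suc (n + m) ^ e))
    (cong (a * c *_) (sym (ℕₚ.^-distribˡ-+-* (suc (n + m)) d e)))))

gapBound-polynomial : Polynomial (λ n _ → gapBound n)
gapBound-polynomial = (var₁ ⊹ var₁ ⊹ con 1) ⊛ (var₁ ⊹ var₁ ⊹ con 1 ⊹ con 1) ⊹ (con 2 ⊹ (var₁ ⊹ var₁ ⊹ (con 2 ⊹ var₁)))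

stepCost-polynomial : Polynomial F → Polynomial G → Polynomial (λ n m → stepCost (F n m) (G n m))
stepCost-polynomial g k = double (double (double (con 5 ⊹ (g ⊛ (con 6 ⊹ k) ⊹ con 3))))
  where
  double : ∀ {H} → Polynomial H → Polynomial _
  double j = con 2 ⊹ (j ⊹ j ⊹ (g ⊛ con 9 ⊹ con 3))

stageLength-polynomial : Polynomial (λ n _ → stageLength n)
stageLength-polynomial = stepCost-polynomial gapBound-polynomial (var₁ ⊛ con 14 ⊹ con 8) ⊹ con 3

lineBound-polynomial : Polynomial (λ n _ → lineBound n)
lineBound-polynomial = stageLength-polynomial ⊛ (con 3 ⊹ (gapBound-polynomial ⊹ (var₁ ⊹ con 1)))

sizeBound-polynomial : Polynomial sizeBound
sizeBound-polynomial =
  (con 1 ⊹ (var₁ ⊹ (con 1 ⊹ var₂)) ⊛ ((con 1 ⊹ (var₁ ⊛ var₂ ⊹ (con 1 ⊹ var₂ ⊛ con 4))) ⊛ (con 1 ⊹ stageLength-polynomial)))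
    ⊛ (con 1 ⊹ lineBound-polynomial ⊛ con 7)

-- Without variables, unsatisfiability means that some equation reads 0 = 1. Its only inequality,
-- for T empty, is already -1 ≥ 0: one line with one term, of size 2.
refutation₀ : ∀ {m} (𝔼 : Instance 0 m) → Unsatisfiable 𝔼 → Σ (List (Poly 0)) λ π →
  Refutation (S 𝔼) π × DegreeAtMost 6 π × proofSize π ≤ 2
refutation₀ 𝔼 unsat with Finₚ.any? (λ j → b (𝔼 j) Boolₚ.≟ true)
... | no  allFalse = ⊥-elim (unsat ((λ ()) , λ j → satisfied (λ ()) (𝔼 j) (λ h → allFalse (j , h))))
  where
  satisfied : ∀ a (E : Equation 0) → b E ≢ true → SatEq a E
  satisfied a (mkEq [] _ false) _ = refl
  satisfied a (mkEq [] _ true)  h = ⊥-elim (h refl)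
... | yes (j , bj) = ineqPoly (I (𝔼 j)) [] ∷ []
  , ((hyp (j , [] , (λ ()) , odd-rhs , λ _ → refl) ∷ []) , λ _ → refl)
  , ((z≤n ∷ []) ∷ []) , s≤s (s≤s z≤n)
  where
  odd-rhs : bitℕ (b (𝔼 j)) % 2 ≡ 1
  odd-rhs = cong (λ c → bitℕ c % 2) bj

-- The 2 covers instances without variables. The sum of multiplier and exponent dominates both, so
-- it can serve as the single constant c.
bounded⇒theorem : Polynomial (λ n m → 2 + sizeBound n m) →
  Σ ℕ λ c → (n m : ℕ) → (𝔼 : Instance n m) → Unsatisfiable 𝔼 →
    Σ (List (Poly n)) λ π →
    Refutation (S 𝔼) π × DegreeAtMost 6 π × (proofSize π ≤ c * (suc (n + m)) ^ c)
bounded⇒theorem (polynomial a e bound) = a + e , refute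
  where
  enough : ∀ n m → 2 + sizeBound n m ≤ (a + e) * suc (n + m) ^ (a + e)
  enough n m = ℕₚ.≤-trans (bound n m)
    (ℕₚ.*-mono-≤ (ℕₚ.m≤m+n a e) (^-mono (n + m) (ℕₚ.m≤n+m e a)))

  refute : (n m : ℕ) → (𝔼 : Instance n m) → Unsatisfiable 𝔼 → Σ (List (Poly n)) λ π →
    Refutation (S 𝔼) π × DegreeAtMost 6 π × (proofSize π ≤ (a + e) * (suc (n + m)) ^ (a + e))
  refute zero m 𝔼 unsat =
    let π , r , d , s = refutation₀ 𝔼 unsat in π , r , d , ℕₚ.≤-trans s (ℕₚ.≤-trans (ℕₚ.m≤m+n 2 (sizeBound 0 m)) (enough 0 m))
  refute (suc n) m 𝔼 unsat =
    let π , r , d , s = refutation 𝔼 unsat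
    in π , r , d , ℕₚ.≤-trans s (ℕₚ.≤-trans (ℕₚ.m≤n+m (sizeBound (suc n) m) 2) (enough (suc n) m))

theorem7p4 : Σ ℕ λ c → (n m : ℕ) → (𝔼 : Instance n m) → Unsatisfiable 𝔼 →
    Σ (List (Poly n)) λ π →
    Refutation (S 𝔼) π × DegreeAtMost 6 π × (proofSize π ≤ c * (suc (n + m)) ^ c)
theorem7p4 = bounded⇒theorem (con 2 ⊹ sizeBound-polynomial)
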